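{- Let $(\mathbb{N},\mathcal{E})$ be a non-amenable coarse space of bounded geometry. Assume that there exists a highly computable symmetric entourage $E\in\mathcal{E}$ such that $|E[F]|\geq 6|F|$ for all finite $F\subset\mathbb{N}$. Then there are two computable permutations $\sigma,\pi\in \mathrm{Sym}(\mathbb{N})$ such that $\langle\sigma,\pi\rangle$ is a free (of rank $2$) semi-regular subgroup of the wobbling group $\mathcal{W}(\mathbb{N},\mathcal{E})$.
   Context: For a relation $E\subseteq X\times X$, $x\in X$ and $A\subseteq X$, put $E[x]:=\{y\in X : (x,y)\in E\}$ and $E[A]:=\bigcup_{x\in A}E[x]$. A coarse space is a pair $(X,\mathcal{E})$ where $X$ is a set and $\mathcal{E}$ is a collection of subsets of $X\times X$ (called entourages) such that: the diagonal $\Delta_X\in\mathcal{E}$; if $F\subseteq E\in\mathcal{E}$ then $F\in\mathcal{E}$; if $E,F\in\mathcal{E}$ then $E\cup F,\ E^{ -1},\ E\circ F\in\mathcal{E}$. It has bounded geometry if for each $E\in\mathcal{E}$ and every $x\in X$ the set $E[x]$ is finite. A coarse space $(X,\mathcal{E})$ of bounded geometry is amenable if for every $\theta>1$ and every $E\in\mathcal{E}$ there is a non-empty finite $F\subseteq X$ with $|E[F]|\leq\theta|F|$; otherwise it is non-amenable. The wobbling group is $\mathcal{W}(X,\mathcal{E}):=\{\alpha\in \mathrm{Sym}(X) : \{(x,\alpha(x)) : x\in X\}\in\mathcal{E}\}$. A subgroup $G\leq \mathrm{Sym}(X)$ is semi-regular if no non-identity element of $G$ has a fixed point in $X$. A symmetric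 relation $E\subseteq\mathbb{N}\times\mathbb{N}$ is highly computable if it is a computable set of pairs, every $E[n]$ is finite, and the function $n\mapsto|E[n]|$ is computable. -}

module Defs where

open import Algebra.Bundles using (Group)
open import Algebra.Morphism.Structures using (module GroupMorphisms)
open import Data.Fin.Base using (Fin)
open import Data.Integer.Base as ℤ using ()
open import Data.List.Base using (List; []; _∷_; _++_; length)
open import Data.List.Properties using (++-assoc; ++-identityʳ)
import Data.List.Membership.Propositional as List
open import Data.List.Relation.Unary.Unique.Propositional using (Unique)
open import Data.Nat.Base as ℕ using (ℕ; zero; suc)
open import Data.Product.Base using (Σ; ∃; ∃-syntax; _×_; _,_; proj₁)
open import Data.Rational.Base as ℚ using (ℚ; 1ℚ)
open import Data.Sign.Base using (Sign; opposite)
open import Data.Sign.Properties using (opposite-selfInverse)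
open import Data.Sum.Base using (_⊎_)
open import Data.Vec.Base using (Vec; []; _∷_; lookup)
open import Data.Vec.Relation.Binary.Pointwise.Inductive using (Pointwise)
open import Function.Base using (flip; _∘_)
open import Function.Bundles using (_↔_; Inverse)
open import Function.Construct.Composition using (_↔-∘_)
open import Function.Properties.Inverse using (↔-refl; ↔-sym)
open import Level using (Level; 0ℓ; _⊔_) renaming (suc to lsuc)
open import Relation.Binary.Construct.Closure.Equivalence as EqC using (EqClosure)
open import Relation.Binary.Construct.Composition using (_;_)
open import Relation.Binary.Construct.Union using () renaming (_∪_ to _∪ᵣ_)
open import Relation.Binary.Core using (Rel; _⇒_)
open import Relation.Binary.Definitions using (Symmetric; _Respects_)
open import Relation.Binary.PropositionalEquality
  using (_≡_; refl; sym; trans; cong; subst; subst₂; module ≡-Reasoning)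
open import Relation.Nullary using (¬_)
open import Relation.Unary using (Pred; _∈_; _⊆_; _≐_)

private
  variable
    a c p ℓ : Level

------------------------------------------------------------------------
-- Finite sets and cardinalities

-- A listing may repeat elements and contain non-members, so that every
-- subset of a finite set is finite without excluded middle.  Classically
-- this is the usual notion.  The same applies to `AtMost`.
Finite : {X : Set a} → Pred X p → Set (a ⊔ p)
Finite A = ∃[ xs ] A ⊆ (List._∈ xs)

AtMost : {X : Set a} → Pred X p → ℕ → Set (a ⊔ p)
AtMost A n = ∃[ xs ] length xs ℕ.≤ n × A ⊆ (List._∈ xs)

HasSize : {X : Set a} → Pred X p → ℕ → Set (a ⊔ p)
HasSize A n = ∃[ xs ] Unique xs × length xs ≡ n × A ≐ (List._∈ xs)

------------------------------------------------------------------------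
-- Dedekind reals

record ℝ : Set₁ where
  field
    lower upper   : Pred ℚ 0ℓ
    lower-inhab   : ∃ lower
    upper-inhab   : ∃ upper
    lower-closed  : ∀ {p q} → p ℚ.< q → q ∈ lower → p ∈ lower
    upper-closed  : ∀ {p q} → p ℚ.< q → p ∈ upper → q ∈ upper
    lower-rounded : ∀ {p} → p ∈ lower → ∃[ q ] p ℚ.< q × q ∈ lower
    upper-rounded : ∀ {q} → q ∈ upper → ∃[ p ] p ℚ.< q × p ∈ upper
    disjoint      : ∀ {q} → ¬ (q ∈ lower × q ∈ upper)
    located       : ∀ {p q} → p ℚ.< q → p ∈ lower ⊎ q ∈ upper

1<_ : ℝ → Set
1< θ = 1ℚ ∈ ℝ.lower θ

fromℕ : ℕ → ℚ
fromℕ n = ℤ.+ n ℚ./ 1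

-- k ≤ θ m for a real θ, i.e. k ≤ q m for every rational q > θ.
_≤_·_ : ℕ → ℝ → ℕ → Set
k ≤ θ · m = ∀ {q} → q ∈ ℝ.upper θ → fromℕ k ℚ.≤ q ℚ.* fromℕ m

------------------------------------------------------------------------
-- Coarse spaces

_[_] : {X : Set} → Rel X 0ℓ → Pred X 0ℓ → Pred X 0ℓ
(E [ A ]) y = ∃[ x ] x ∈ A × E x y

record CoarseSpace (X : Set) (ℓ : Level) : Set (lsuc (0ℓ ⊔ ℓ)) where
  field
    IsEntourage : Pred (Rel X 0ℓ) ℓ
    diagonal    : IsEntourage _≡_
    downward    : ∀ {E F} → F ⇒ E → IsEntourage E → IsEntourage F
    union       : ∀ {E F} → IsEntourage E → IsEntourage F → IsEntourage (E ∪ᵣ F)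
    inverse     : ∀ {E} → IsEntourage E → IsEntourage (flip E)
    composition : ∀ {E F} → IsEntourage E → IsEntourage F → IsEntourage (E ; F)

module _ {X : Set} (𝓔 : CoarseSpace X ℓ) where
  open CoarseSpace 𝓔

  BoundedGeometry : Set (lsuc 0ℓ ⊔ ℓ)
  BoundedGeometry = ∀ {E} → IsEntourage E → ∀ x → Finite (E x)

  Amenable : Set (lsuc 0ℓ ⊔ ℓ)
  Amenable = ∀ θ → 1< θ → ∀ {E} → IsEntourage E →
    ∃[ F ] ∃[ m ] ∃[ k ]
      ∃ (_∈ F) × HasSize F m × AtMost (E [ F ]) k × k ≤ θ · m

  NonAmenable : Set (lsuc 0ℓ ⊔ ℓ)
  NonAmenable = ¬ Amenable

------------------------------------------------------------------------
-- μ-recursive functions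

data Code : ℕ → Set where
  zero : Code 0
  suc  : Code 1
  proj : ∀ {n} → Fin n → Code n
  comp : ∀ {m n} → Code m → Vec (Code n) m → Code n
  prec : ∀ {n} → Code n → Code (2 ℕ.+ n) → Code (1 ℕ.+ n)
  min  : ∀ {n} → Code (1 ℕ.+ n) → Code n

infix 4 _⟨_⟩⇓_

data _⟨_⟩⇓_ : ∀ {n} → Code n → Vec ℕ n → ℕ → Set where
  zero : zero ⟨ [] ⟩⇓ 0
  suc  : ∀ {x} → suc ⟨ x ∷ [] ⟩⇓ suc x
  proj : ∀ {n xs} (i : Fin n) → proj i ⟨ xs ⟩⇓ lookup xs i
  comp : ∀ {m n xs ys y} {f : Code m} {gs : Vec (Code n) m} →
         Pointwise (_⟨ xs ⟩⇓_) gs ys → f ⟨ ys ⟩⇓ y →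
         comp f gs ⟨ xs ⟩⇓ y
  prec-zero : ∀ {n xs y} {f : Code n} {g} →
              f ⟨ xs ⟩⇓ y → prec f g ⟨ 0 ∷ xs ⟩⇓ y
  prec-suc  : ∀ {n xs k y z} {f : Code n} {g} →
              prec f g ⟨ k ∷ xs ⟩⇓ y → g ⟨ k ∷ y ∷ xs ⟩⇓ z →
              prec f g ⟨ suc k ∷ xs ⟩⇓ z
  min  : ∀ {n xs k} {f : Code (1 ℕ.+ n)} →
         f ⟨ k ∷ xs ⟩⇓ 0 →
         (∀ {j} → j ℕ.< k → ∃[ y ] f ⟨ j ∷ xs ⟩⇓ suc y) →
         min f ⟨ xs ⟩⇓ k

Computable : (ℕ → ℕ) → Set
Computable f = ∃[ e ] ∀ x → e ⟨ x ∷ [] ⟩⇓ f x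

Computable₂ : (ℕ → ℕ → ℕ) → Set
Computable₂ f = ∃[ e ] ∀ x y → e ⟨ x ∷ y ∷ [] ⟩⇓ f x y

ComputableRelation : Rel ℕ 0ℓ → Set
ComputableRelation E = ∃[ χ ] Computable₂ χ ×
  (∀ x y → (E x y × χ x y ≡ 1) ⊎ (¬ E x y × χ x y ≡ 0))

record HighlyComputable (E : Rel ℕ 0ℓ) : Set where
  field
    symmetric  : Symmetric E
    computable : ComputableRelation E
    finite     : ∀ n → Finite (E n)
    size       : ∃[ s ] Computable s × (∀ n → HasSize (E n) (s n))

------------------------------------------------------------------------
-- Subgroups

module _ (G : Group c ℓ) where
  open Group G

  record IsSubgroup (H : Pred Carrier p) : Set (c ⊔ ℓ ⊔ p) where
    field
      resp      : H Respects _≈_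
      ε-closed  : ε ∈ H
      ∙-closed  : ∀ {x y} → x ∈ H → y ∈ H → x ∙ y ∈ H
      ⁻¹-closed : ∀ {x} → x ∈ H → x ⁻¹ ∈ H

  subgroup : {H : Pred Carrier p} → IsSubgroup H → Group (c ⊔ p) ℓ
  subgroup {H = H} isSubgroup = record
    { Carrier = Σ Carrier H
    ; _≈_     = λ x y → proj₁ x ≈ proj₁ y
    ; _∙_     = λ (x , x∈H) (y , y∈H) → x ∙ y , ∙-closed x∈H y∈H
    ; ε       = ε , ε-closed
    ; _⁻¹     = λ (x , x∈H) → x ⁻¹ , ⁻¹-closed x∈H
    ; isGroup = record
      { isMonoid = record
        { isSemigroup = record
          { isMagma = record
            { isEquivalence = record
              { refl = Group.refl G ; sym = Group.sym G ; trans = Group.trans G }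
            ; ∙-cong = ∙-cong
            }
          ; assoc = λ x y z → assoc (proj₁ x) (proj₁ y) (proj₁ z)
          }
        ; identity = identityˡ ∘ proj₁ , identityʳ ∘ proj₁
        }
      ; inverse = inverseˡ ∘ proj₁ , inverseʳ ∘ proj₁
      ; ⁻¹-cong = ⁻¹-cong
      }
    }
    where open IsSubgroup isSubgroup

  data Generated (S : Pred Carrier p) : Pred Carrier (c ⊔ ℓ ⊔ p) where
    gen  : ∀ {x} → x ∈ S → Generated S x
    resp : (Generated S) Respects _≈_
    unit : Generated S ε
    mul  : ∀ {x y} → Generated S x → Generated S y → Generated S (x ∙ y)
    inv  : ∀ {x} → Generated S x → Generated S (x ⁻¹)

  generated-isSubgroup : (S : Pred Carrier p) → IsSubgroup (Generated S)
  generated-isSubgroup S = record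
    { resp = resp ; ε-closed = unit ; ∙-closed = mul ; ⁻¹-closed = inv }

------------------------------------------------------------------------
-- Free groups

module _ (A : Set a) where

  -- The letter (x , s) stands for x if s = + and for x⁻¹ if s = -.
  Word : Set a
  Word = List (A × Sign)

  data _⟶_ : Rel Word a where
    cancel : ∀ u x s v → (u ++ (x , s) ∷ (x , opposite s) ∷ v) ⟶ (u ++ v)

  invert : Word → Word
  invert []            = []
  invert ((x , s) ∷ w) = invert w ++ ((x , opposite s) ∷ [])

  private
    _≈_ : Rel Word a
    _≈_ = EqClosure _⟶_

    opposite² : ∀ s → opposite (opposite s) ≡ s
    opposite² s = opposite-selfInverse {s} refl

    ++-congˡ : ∀ w {u v} → u ≈ v → (w ++ u) ≈ (w ++ v)
    ++-congˡ w = EqC.gmap (w ++_) step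
      where
      step : ∀ {u v} → u ⟶ v → (w ++ u) ⟶ (w ++ v)
      step (cancel u x s v) =
        subst₂ _⟶_ (++-assoc w u _) (++-assoc w u v) (cancel (w ++ u) x s v)

    ++-congʳ : ∀ w {u v} → u ≈ v → (u ++ w) ≈ (v ++ w)
    ++-congʳ w = EqC.gmap (_++ w) step
      where
      step : ∀ {u v} → u ⟶ v → (u ++ w) ⟶ (v ++ w)
      step (cancel u x s v) =
        subst₂ _⟶_ (sym (++-assoc u _ w)) (sym (++-assoc u v w)) (cancel u x s (v ++ w))

    invert-++ : ∀ u v → invert (u ++ v) ≡ invert v ++ invert u
    invert-++ []            v = sym (++-identityʳ (invert v))
    invert-++ ((x , s) ∷ u) v =
      trans (cong (_++ ((x , opposite s) ∷ [])) (invert-++ u v))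
            (++-assoc (invert v) (invert u) _)

    invert-cong : ∀ {u v} → u ≈ v → invert u ≈ invert v
    invert-cong = EqC.gmap invert step
      where
      open ≡-Reasoning
      lhs : ∀ u x s v →
        invert v ++ (x , opposite (opposite s)) ∷ (x , opposite s) ∷ invert u
          ≡ invert (u ++ (x , s) ∷ (x , opposite s) ∷ v)
      lhs u x s v = begin
        invert v ++ x″ ∷ x′ ∷ invert u
          ≡⟨ ++-assoc (invert v) (x″ ∷ []) (x′ ∷ invert u) ⟨
        (invert v ++ (x″ ∷ [])) ++ x′ ∷ invert u
          ≡⟨ ++-assoc (invert v ++ (x″ ∷ [])) (x′ ∷ []) (invert u) ⟨
        ((invert v ++ (x″ ∷ [])) ++ (x′ ∷ [])) ++ invert u
          ≡⟨ invert-++ u ((x , s) ∷ x′ ∷ v) ⟨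
        invert (u ++ (x , s) ∷ x′ ∷ v) ∎
        where
        x′ x″ : A × Sign
        x′ = x , opposite s
        x″ = x , opposite (opposite s)

      step : ∀ {u v} → u ⟶ v → invert u ⟶ invert v
      step (cancel u x s v) =
        subst₂ _⟶_
          (trans (cong (λ t → invert v ++ (x , opposite (opposite s)) ∷ (x , t) ∷ invert u)
                       (opposite² (opposite s)))
                 (lhs u x s v))
          (sym (invert-++ u v))
          (cancel (invert v) x (opposite (opposite s)) (invert u))

    invertʳ : ∀ w → (w ++ invert w) ≈ []
    invertʳ []            = EqC.reflexive _⟶_
    invertʳ ((x , s) ∷ w) = EqC.transitive _⟶_
      (subst (λ t → ((x , s) ∷ t) ≈ ((x , s) ∷ ((x , opposite s) ∷ [])))
        (++-assoc w (invert w) ((x , opposite s) ∷ []))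
        (++-congˡ ((x , s) ∷ []) (++-congʳ ((x , opposite s) ∷ []) (invertʳ w))))
      (EqC.return (cancel [] x s []))

    invertˡ : ∀ w → (invert w ++ w) ≈ []
    invertˡ []            = EqC.reflexive _⟶_
    invertˡ ((x , s) ∷ w) = EqC.transitive _⟶_
      (EqC.return (subst (_⟶ (invert w ++ w))
        (trans (cong (λ t → invert w ++ (x , opposite s) ∷ (x , t) ∷ w) (opposite² s))
               (sym (++-assoc (invert w) ((x , opposite s) ∷ []) ((x , s) ∷ w))))
        (cancel (invert w) x (opposite s) w)))
      (invertˡ w)

  FreeGroup : Group a a
  FreeGroup = record
    { Carrier = Word
    ; _≈_     = _≈_
    ; _∙_     = _++_
    ; ε       = []
    ; _⁻¹     = invert
    ; isGroup = record
      { isMonoid = record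
        { isSemigroup = record
          { isMagma = record
            { isEquivalence = EqC.isEquivalence _⟶_
            ; ∙-cong = λ {u} {v} {w} {z} u≈v w≈z →
                EqC.transitive _⟶_ (++-congʳ w u≈v) (++-congˡ v w≈z)
            }
          ; assoc = λ u v w → ≡⇒≈ (++-assoc u v w)
          }
        ; identity = (λ w → ≡⇒≈ refl) , (λ w → ≡⇒≈ (++-identityʳ w))
        }
      ; inverse = invertˡ , invertʳ
      ; ⁻¹-cong = invert-cong
      }
    }
    where
    ≡⇒≈ : ∀ {u v} → u ≡ v → u ≈ v
    ≡⇒≈ refl = EqC.reflexive _⟶_

FreeOfRank : ℕ → Group c ℓ → Set (c ⊔ ℓ)
FreeOfRank n G = ∃[ φ ] IsGroupIsomorphism φ
  where open GroupMorphisms (Group.rawGroup (FreeGroup (Fin n))) (Group.rawGroup G)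

------------------------------------------------------------------------
-- Permutation groups

Sym : Set → Group 0ℓ 0ℓ
Sym X = record
  { Carrier = X ↔ X
  ; _≈_     = λ f g → ∀ x → to f x ≡ to g x
  ; _∙_     = _↔-∘_
  ; ε       = ↔-refl
  ; _⁻¹     = ↔-sym
  ; isGroup = record
    { isMonoid = record
      { isSemigroup = record
        { isMagma = record
          { isEquivalence = record
            { refl  = λ _ → refl
            ; sym   = λ f≈g x → sym (f≈g x)
            ; trans = λ f≈g g≈h x → trans (f≈g x) (g≈h x)
            }
          ; ∙-cong = λ {f} {g} {h} {k} f≈g h≈k x →
              trans (cong (to f) (h≈k x)) (f≈g (to k x))
          }
        ; assoc = λ _ _ _ _ → refl
        }
      ; identity = (λ _ _ → refl) , (λ _ _ → refl)
      }
    ; inverse = strictlyInverseʳ , strictlyInverseˡ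
    ; ⁻¹-cong = λ {f} {g} f≈g x →
        trans (cong (from f) (trans (sym (strictlyInverseˡ g x)) (sym (f≈g (from g x)))))
              (strictlyInverseʳ f (from g x))
    }
  }
  where open Inverse

SemiRegular : {X : Set} → Pred (X ↔ X) p → Set p
SemiRegular {X = X} H =
  ∀ {α} → α ∈ H → ¬ (α ≈ ε) → ∀ x → ¬ (Inverse.to α x ≡ x)
  where open Group (Sym X)

Wobbling : {X : Set} → CoarseSpace X ℓ → Pred (X ↔ X) ℓ
Wobbling 𝓔 α = CoarseSpace.IsEntourage 𝓔 (λ x y → Inverse.to α x ≡ y)

wobbling-isSubgroup : {X : Set} (𝓔 : CoarseSpace X ℓ) → IsSubgroup (Sym X) (Wobbling 𝓔)
wobbling-isSubgroup 𝓔 = record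
  { resp      = λ α≈β → downward λ {x} βx≡y → trans (α≈β x) βx≡y
  ; ε-closed  = diagonal
  ; ∙-closed  = λ {α} {β} α∈W β∈W →
      downward (λ {x} αβx≡y → to β x , refl , αβx≡y) (composition β∈W α∈W)
  ; ⁻¹-closed = λ {α} α∈W →
      downward (λ {x} α⁻¹x≡y → trans (cong (to α) (sym α⁻¹x≡y)) (strictlyInverseˡ α x))
               (inverse α∈W)
  }
  where
  open CoarseSpace 𝓔
  open Inverse using (to; strictlyInverseˡ)

ComputablePermutation : Pred (ℕ ↔ ℕ) 0ℓ
ComputablePermutation σ = Computable (Inverse.to σ)

{-# OPTIONS --safe #-}
module Submission where

-- Since |E[F]| ≥ 6|F|, Hall's condition for giving every vertex five children of
-- its own among its E-neighbours holds with slack.  The slack bounds the size and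
-- the location of the sets on which the condition can fail after finitely many
-- children have been handed out, so a child that preserves it can be found by a
-- finite check and the assignment is computable.  The resulting parent function may
-- have cycles and infinite ascending paths; cutting the path from 0, 1, 2, … in turn
-- as low as possible makes it a well-founded forest and costs every vertex at most
-- two children.  Such a forest contains a spanning 3-regular forest whose edges are
-- coloured, downwards from the roots, with three colours.  The colour classes are
-- three involutions a, b, c that move points along E and generate a freely acting
-- Z/2 * Z/2 * Z/2, and ab and bc generate a free subgroup of rank 2.

open import Defs
open import Data.Nat using (ℕ; _*_; _≥_)
open import Data.Product using (∃-syntax; _×_)
open import Function.Bundles using (_↔_)
open import Level using (Level; 0ℓ)
open import Relation.Binary.Core using (Rel)
open import Relation.Unary using (Pred; _⊆_; _∪_; ｛_｝)

open import Algebra.Bundles using (Group)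
import Algebra.Properties.CommutativeSemigroup as CommutativeSemigroupProperties
import Algebra.Properties.Group as GroupProperties
open import Data.Bool.Base using (Bool; true; false; not; _∧_; _∨_; if_then_else_)
open import Data.Bool.Properties using (T-≡; ¬-not; not-involutive; ∨-zeroʳ; ∨-identityʳ)
open import Data.Empty using (⊥; ⊥-elim)
open import Data.Fin.Base as Fin using (Fin; zero; suc; toℕ)
open import Data.Fin.Patterns using (0F; 1F; 2F; 3F; 4F)
import Data.Fin.Properties as Fin
open import Data.List.Base using (List; []; _∷_; _++_; length)
import Data.List.Membership.Propositional as List
open import Data.List.Membership.Propositional.Properties.WithK using (unique∧set⇒bag)
open import Data.List.Relation.Binary.BagAndSetEquality using (∼bag⇒↭)
open import Data.List.Relation.Binary.Permutation.Propositional.Properties using (↭-length)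
import Data.List.Relation.Unary.All as All
open import Data.List.Relation.Unary.AllPairs using ([]; _∷_)
open import Data.List.Relation.Unary.Any using (here; there)
open import Data.List.Relation.Unary.Linked as Linked using (Linked; []; [-]; _∷_)
open import Data.List.Relation.Unary.Unique.Propositional using (Unique)
open import Data.Nat.Base
open import Data.Nat.Induction using (<-rec)
open import Data.Nat.Properties
open import Data.Nat.Solver using (module +-*-Solver)
open import Data.Product.Base using (_,_; proj₁; proj₂)
open import Data.Product.Properties using (≡-dec)
open import Data.Sign.Base as Sign using (Sign; opposite)
import Data.Sign.Properties as Sign using (_≟_)
open import Data.Sum.Base as Sum using (_⊎_; inj₁; inj₂)
open import Data.Vec.Base as Vec using (Vec; []; _∷_; lookup)
open import Data.Vec.Properties using (tabulate∘lookup)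
open import Data.Vec.Relation.Binary.Pointwise.Inductive using (Pointwise; []; _∷_; tabulate⁺)
open import Function.Base using (_∘_)
open import Function.Bundles using (Equivalence; Inverse; mk⇔; mk↔ₛ′)
open import Function.Construct.Composition using (_↔-∘_)
import Relation.Binary.Construct.Closure.Equivalence as EqC
open import Relation.Binary.Definitions using (tri<; tri≈; tri>)
open import Relation.Binary.PropositionalEquality
  using (_≡_; _≢_; refl; sym; trans; cong; cong₂; subst; module ≡-Reasoning)
import Relation.Binary.Reasoning.Setoid as SetoidReasoning
open import Relation.Nullary using (¬_; contradiction; yes; no; Dec)

open CommutativeSemigroupProperties +-commutativeSemigroup using (interchange)
open +-*-Solver using (solve; con; _:+_; _:*_; _:=_)

-- Five children are asked for because cutting can take two and three must remain: a root has no
-- edge upwards and needs a child for each of the three colours. The two arise because, of two cut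
-- children of one vertex, the one cut later lies on a cycle, and a vertex has at most one child on
-- a cycle. Counting every vertex five times turns the factor 6 into |N(F)| ≥ 6/5 |F|; the surplus
-- |F|/5 is the slack.
--
-- The cutting is forced by computability. That a parent path never closes up cannot be seen from a
-- finite part of it, while a colour can be computed only once the path to a root is known. Stage n
-- therefore looks at n + 1 ancestors only: as there are n earlier stages, either one of these
-- ancestors lies above no earlier cut, or two of them agree and the path has closed up.
--
-- With involutions, freeness becomes the absence of closed paths without backtracking in a forest,
-- and each of the two generators moves a point by two steps along E.

module RecursiveFunctions where

  -- Closure properties of μ-recursive functions and predicates

  private
    variable
      m n : ℕ

  bit : Bool → ℕ
  bit false = 0
  bit true  = 1

  record Recursive (f : Vec ℕ n → ℕ) : Set where
    constructor recursive
    field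
      code : Code n
      computes : ∀ xs → code ⟨ xs ⟩⇓ f xs

  record RecursiveP (P : Vec ℕ n → Bool) : Set where
    constructor recursiveP
    field
      rec : Recursive (λ xs → bit (P xs))

  open Recursive
  open RecursiveP

  Recursive-cong : {f g : Vec ℕ n → ℕ} → (∀ xs → f xs ≡ g xs) → Recursive f → Recursive g
  Recursive-cong f≗g (recursive e ev) = recursive e λ xs → subst (e ⟨ xs ⟩⇓_) (f≗g xs) (ev xs)

  toComputable : {f : ℕ → ℕ} → Recursive {1} (λ xs → f (lookup xs 0F)) → Computable f
  toComputable r = code r , λ x → computes r (x ∷ [])

  rename : (ρ : Fin m → Fin n) {f : Vec ℕ m → ℕ} → Recursive f →
           Recursive (λ xs → f (Vec.tabulate λ i → lookup xs (ρ i)))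
  rename ρ rf = recursive (comp (code rf) (Vec.tabulate λ i → proj (ρ i)))
    λ xs → comp (tabulate⁺ λ i → proj (ρ i)) (computes rf _)

  tail-rec : {f : Vec ℕ n → ℕ} → Recursive f → Recursive (λ xs → f (Vec.tail xs))
  tail-rec {f = f} rf = Recursive-cong (λ { (_ ∷ xs) → cong f (tabulate∘lookup xs) }) (rename suc rf)

  -- Reinterprets a function of (i , xs) as one of the arguments (i , y , xs) of
  -- the step function of a primitive recursion.
  drop₂ : {f : Vec ℕ (suc n) → ℕ} → Recursive f →
          Recursive (λ xs → f (Vec.head xs ∷ Vec.tail (Vec.tail xs)))
  drop₂ {n} {f} rf = Recursive-cong
    (λ { (k ∷ _ ∷ xs) → cong (λ ys → f (k ∷ ys)) (tabulate∘lookup xs) }) (rename ρ rf)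
    where
    ρ : Fin (suc n) → Fin (suc (suc n))
    ρ zero    = zero
    ρ (suc i) = suc (suc i)

  module _ {n : ℕ} where
    private
      variable
        f g h : Vec ℕ n → ℕ
        P Q : Vec ℕ n → Bool

    var : (i : Fin n) → Recursive (λ xs → lookup xs i)
    var i = recursive (proj i) λ _ → proj i

    app₁ : ∀ {f} → Recursive {1} f → Recursive g → Recursive (λ xs → f (g xs ∷ []))
    app₁ rf rg = recursive (comp (code rf) (code rg ∷ []))
      λ xs → comp (computes rg xs ∷ []) (computes rf _)

    app₂ : ∀ {f} → Recursive {2} f → Recursive g → Recursive h →
           Recursive (λ xs → f (g xs ∷ h xs ∷ []))
    app₂ rf rg rh = recursive (comp (code rf) (code rg ∷ code rh ∷ []))
      λ xs → comp (computes rg xs ∷ computes rh xs ∷ []) (computes rf _)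

    app₃ : ∀ {f k} → Recursive {3} f → Recursive g → Recursive h → Recursive k →
           Recursive (λ xs → f (g xs ∷ h xs ∷ k xs ∷ []))
    app₃ rf rg rh rk = recursive (comp (code rf) (code rg ∷ code rh ∷ code rk ∷ []))
      λ xs → comp (computes rg xs ∷ computes rh xs ∷ computes rk xs ∷ []) (computes rf _)

    private
      ids : Vec (Code n) n
      ids = Vec.tabulate proj

      ids-computes : ∀ xs → Pointwise (_⟨ xs ⟩⇓_) ids xs
      ids-computes xs = subst (Pointwise (_⟨ xs ⟩⇓_) ids) (tabulate∘lookup xs)
        (tabulate⁺ {f = proj} {g = lookup xs} λ i → proj i)

    -- The step equation is required only at the values `F k xs` that occur, so `s` may rest on
    -- identities that fail for other numbers: `1 ∸ x` negates `x` only if `x` is a bit.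
    primrec : (F : ℕ → Vec ℕ n → ℕ) {s : Vec ℕ (2 + n) → ℕ} → Recursive (F 0) → Recursive {2 + n} s →
              (∀ k xs → s (k ∷ F k xs ∷ xs) ≡ F (suc k) xs) →
              Recursive h → Recursive (λ xs → F (h xs) xs)
    primrec {h = h} F {s} rz rs step rh =
      recursive (comp (prec (code rz) (code rs)) (code rh ∷ ids))
        λ xs → comp (computes rh xs ∷ ids-computes xs) (go xs (h xs))
      where
      go : ∀ xs k → prec (code rz) (code rs) ⟨ k ∷ xs ⟩⇓ F k xs
      go xs zero    = prec-zero (computes rz xs)
      go xs (suc k) = prec-suc (go xs k)
        (subst (code rs ⟨ k ∷ F k xs ∷ xs ⟩⇓_) (step k xs) (computes rs _))

    suc-rec : Recursive g → Recursive (λ xs → suc (g xs))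
    suc-rec rg = recursive (comp suc (code rg ∷ [])) λ xs → comp (computes rg xs ∷ []) suc

    const-rec : ∀ c → Recursive {n} (λ _ → c)
    const-rec zero    = recursive (comp zero []) λ xs → comp [] zero
    const-rec (suc c) = suc-rec (const-rec c)

    case-rec : Recursive h → Recursive f → Recursive g →
               Recursive (λ xs → if 0 <ᵇ h xs then f xs else g xs)
    case-rec {f = f} {g = g} rh rf rg =
      primrec (λ k xs → if 0 <ᵇ k then f xs else g xs) {λ xs → f (Vec.tail (Vec.tail xs))} rg
        (tail-rec (tail-rec rf))
        (λ _ _ → refl) rh

    if-rec : RecursiveP P → Recursive f → Recursive g →
             Recursive (λ xs → if P xs then f xs else g xs)
    if-rec {P = P} {f = f} {g = g} rP rf rg = Recursive-cong eq (case-rec (rec rP) rf rg)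
      where
      eq : ∀ xs → (if 0 <ᵇ bit (P xs) then f xs else g xs) ≡ (if P xs then f xs else g xs)
      eq xs with P xs
      ... | true  = refl
      ... | false = refl

  private
    variable
      f g h : Vec ℕ n → ℕ
      P Q : Vec ℕ n → Bool

  app₂P : {P : Vec ℕ 2 → Bool} → RecursiveP P → Recursive f → Recursive g →
           RecursiveP (λ xs → P (f xs ∷ g xs ∷ []))
  app₂P rP rf rg = recursiveP (app₂ (rec rP) rf rg)

  +-rec : Recursive f → Recursive g → Recursive (λ xs → f xs + g xs)
  +-rec rf rg = app₂ {f = λ xs → lookup xs 0F + lookup xs 1F}
    (primrec (λ k xs → k + lookup xs 1F) (var 1F) (suc-rec (var 1F)) (λ _ _ → refl) (var 0F))
    rf rg

  *-rec : Recursive f → Recursive g → Recursive (λ xs → f xs * g xs)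
  *-rec rf rg = app₂ {f = λ xs → lookup xs 0F * lookup xs 1F}
    (primrec (λ k xs → k * lookup xs 1F) (const-rec 0) (+-rec (var 3F) (var 1F))
      (λ _ _ → refl) (var 0F))
    rf rg

  pred-rec : Recursive f → Recursive (λ xs → pred (f xs))
  pred-rec rf = app₁ {f = λ xs → pred (lookup xs 0F)}
    (primrec (λ k _ → pred k) (const-rec 0) (var 0F) (λ _ _ → refl) (var 0F)) rf

  ∸-rec : Recursive f → Recursive g → Recursive (λ xs → f xs ∸ g xs)
  ∸-rec rf rg = app₂ {f = λ xs → lookup xs 0F ∸ lookup xs 1F}
    (primrec (λ k xs → lookup xs 0F ∸ k) (var 0F) (pred-rec (var 1F))
      (λ k xs → pred[m∸n]≡m∸[1+n] (lookup xs 0F) k) (var 1F))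
    rf rg

  ⊔-rec : Recursive f → Recursive g → Recursive (λ xs → f xs ⊔ g xs)
  ⊔-rec {f = f} {g = g} rf rg =
    Recursive-cong (λ xs → sym (m⊔n≡m+[n∸m] (f xs) (g xs))) (+-rec rf (∸-rec rg rf))
    where
    m⊔n≡m+[n∸m] : ∀ m n → m ⊔ n ≡ m + (n ∸ m)
    m⊔n≡m+[n∸m] zero    n       = refl
    m⊔n≡m+[n∸m] (suc m) zero    = cong suc (sym (+-identityʳ m))
    m⊔n≡m+[n∸m] (suc m) (suc n) = cong suc (m⊔n≡m+[n∸m] m n)

  2^-rec : Recursive f → Recursive (λ xs → 2 ^ f xs)
  2^-rec rf = app₁ {f = λ xs → 2 ^ lookup xs 0F}
    (primrec (λ k _ → 2 ^ k) (const-rec 1) (*-rec (const-rec 2) (var 1F)) (λ _ _ → refl) (var 0F))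
    rf

  not-rec : RecursiveP P → RecursiveP (λ xs → not (P xs))
  not-rec {P = P} rP = recursiveP (Recursive-cong (λ xs → eq (P xs)) (∸-rec (const-rec 1) (rec rP)))
    where
    eq : ∀ b → 1 ∸ bit b ≡ bit (not b)
    eq false = refl
    eq true  = refl

  ∧-rec : RecursiveP P → RecursiveP Q → RecursiveP (λ xs → P xs ∧ Q xs)
  ∧-rec {P = P} {Q = Q} rP rQ =
    recursiveP (Recursive-cong (λ xs → eq (P xs) (Q xs)) (*-rec (rec rP) (rec rQ)))
    where
    eq : ∀ b c → bit b * bit c ≡ bit (b ∧ c)
    eq false _ = refl
    eq true  c = +-identityʳ (bit c)

  ∨-rec : RecursiveP P → RecursiveP Q → RecursiveP (λ xs → P xs ∨ Q xs)
  ∨-rec {P = P} {Q = Q} rP rQ =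
    recursiveP (Recursive-cong (λ xs → eq (P xs) (Q xs)) (⊔-rec (rec rP) (rec rQ)))
    where
    eq : ∀ b c → bit b ⊔ bit c ≡ bit (b ∨ c)
    eq false false = refl
    eq false true  = refl
    eq true  false = refl
    eq true  true  = refl

  <ᵇ-rec : Recursive f → Recursive g → RecursiveP (λ xs → f xs <ᵇ g xs)
  <ᵇ-rec {f = f} {g = g} rf rg = recursiveP
    (Recursive-cong (λ xs → eq (f xs) (g xs)) (case-rec (∸-rec rg rf) (const-rec 1) (const-rec 0)))
    where
    eq : ∀ m n → (if 0 <ᵇ n ∸ m then 1 else 0) ≡ bit (m <ᵇ n)
    eq m       zero    rewrite 0∸n≡0 m = refl
    eq zero    (suc n) = refl
    eq (suc m) (suc n) = eq m n

  ≤ᵇ-rec : Recursive f → Recursive g → RecursiveP (λ xs → f xs ≤ᵇ g xs)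
  ≤ᵇ-rec {f = f} {g = g} rf rg = recursiveP
    (Recursive-cong (λ xs → cong bit (eq (f xs) (g xs))) (rec (not-rec (<ᵇ-rec rg rf))))
    where
    eq : ∀ m n → not (n <ᵇ m) ≡ (m ≤ᵇ n)
    eq zero          n       = refl
    eq (suc m)       zero    = refl
    eq (suc zero)    (suc n) = refl
    eq (suc (suc m)) (suc n) = eq (suc m) n

  ≡ᵇ-rec : Recursive f → Recursive g → RecursiveP (λ xs → f xs ≡ᵇ g xs)
  ≡ᵇ-rec {f = f} {g = g} rf rg = recursiveP
    (Recursive-cong (λ xs → cong bit (eq (f xs) (g xs))) (rec (not-rec (∨-rec (<ᵇ-rec rf rg) (<ᵇ-rec rg rf)))))
    where
    eq : ∀ m n → not ((m <ᵇ n) ∨ (n <ᵇ m)) ≡ (m ≡ᵇ n)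
    eq zero    zero    = refl
    eq zero    (suc n) = refl
    eq (suc m) zero    = refl
    eq (suc m) (suc n) = eq m n

  -- The one use of unbounded minimisation. It serves functions such as `depth` and `rowBound`,
  -- whose bounds come from a proof and not from a `Code`. `min` looks for a zero, so the code that
  -- is searched is that of the negation.
  search-rec : {P : Vec ℕ (suc n) → Bool} → RecursiveP P → (f : Vec ℕ n → ℕ) →
               (∀ xs → P (f xs ∷ xs) ≡ true) → (∀ xs {j} → j < f xs → P (j ∷ xs) ≡ false) →
               Recursive f
  search-rec {P = P} rP f found least = recursive (min (code r)) λ xs → min
    (subst (λ b → code r ⟨ f xs ∷ xs ⟩⇓ bit (not b)) (found xs) (computes r _))
    λ {j} j<f → 0 , subst (λ b → code r ⟨ j ∷ xs ⟩⇓ bit (not b)) (least xs j<f) (computes r _)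
    where
    r = rec (not-rec rP)

open RecursiveFunctions
open Recursive
open RecursiveP

-- Counting and searching below a bound

module Counting where

  ∧-intro : ∀ {a b} → a ≡ true → b ≡ true → a ∧ b ≡ true
  ∧-intro refl refl = refl

  ∧-elimˡ : ∀ {a b} → a ∧ b ≡ true → a ≡ true
  ∧-elimˡ {true} _ = refl

  ∧-elimʳ : ∀ {a b} → a ∧ b ≡ true → b ≡ true
  ∧-elimʳ {true} eq = eq

  ∨-introˡ : ∀ {a b} → a ≡ true → a ∨ b ≡ true
  ∨-introˡ refl = refl

  ∨-introʳ : ∀ {a b} → b ≡ true → a ∨ b ≡ true
  ∨-introʳ {a} refl = ∨-zeroʳ a

  ∨-elim : ∀ {a b} → a ∨ b ≡ true → a ≡ true ⊎ b ≡ true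
  ∨-elim {true}  _  = inj₁ refl
  ∨-elim {false} eq = inj₂ eq

  not-elim : ∀ {a} → not a ≡ true → a ≡ false
  not-elim {false} _ = refl

  true≢false : {a : Bool} → a ≡ true → a ≡ false → ⊥
  true≢false refl ()

  module _ {m n : ℕ} where
    ≡ᵇ-sound : (m ≡ᵇ n) ≡ true → m ≡ n
    ≡ᵇ-sound = ≡ᵇ⇒≡ m n ∘ Equivalence.from T-≡

    ≡ᵇ-complete : m ≡ n → (m ≡ᵇ n) ≡ true
    ≡ᵇ-complete = Equivalence.to T-≡ ∘ ≡⇒≡ᵇ m n

    <ᵇ-sound : (m <ᵇ n) ≡ true → m < n
    <ᵇ-sound = <ᵇ⇒< m n ∘ Equivalence.from T-≡

    <ᵇ-complete : m < n → (m <ᵇ n) ≡ true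
    <ᵇ-complete = Equivalence.to T-≡ ∘ <⇒<ᵇ

    ≤ᵇ-sound : (m ≤ᵇ n) ≡ true → m ≤ n
    ≤ᵇ-sound = ≤ᵇ⇒≤ m n ∘ Equivalence.from T-≡

    ≤ᵇ-complete : m ≤ n → (m ≤ᵇ n) ≡ true
    ≤ᵇ-complete = Equivalence.to T-≡ ∘ ≤⇒≤ᵇ

  private
    variable
      i j k m n : ℕ
      P Q R S : ℕ → Bool

  any : ℕ → (ℕ → Bool) → Bool
  any zero    P = false
  any (suc n) P = P n ∨ any n P

  any-intro : i < n → P i ≡ true → any n P ≡ true
  any-intro {i} {suc n} {P} i<1+n Pi with m<1+n⇒m<n∨m≡n i<1+n
  ... | inj₁ i<n  = ∨-introʳ {P n} (any-intro i<n Pi)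
  ... | inj₂ refl = ∨-introˡ Pi

  any-elim : any n P ≡ true → ∃[ i ] i < n × P i ≡ true
  any-elim {suc n} {P} eq with ∨-elim {P n} eq
  ... | inj₁ Pn = n , n<1+n n , Pn
  ... | inj₂ eq′ with any-elim {n} eq′
  ... | i , i<n , Pi = i , m<n⇒m<1+n i<n , Pi

  count : ℕ → (ℕ → Bool) → ℕ
  count zero    P = 0
  count (suc n) P = bit (P n) + count n P

  bit-mono : ∀ {a b} → (a ≡ true → b ≡ true) → bit a ≤ bit b
  bit-mono {false} _   = z≤n
  bit-mono {true}  a⇒b rewrite a⇒b refl = ≤-refl

  count-mono : ∀ n → (∀ {i} → i < n → P i ≡ true → Q i ≡ true) → count n P ≤ count n Q
  count-mono zero    P⇒Q = z≤n
  count-mono (suc n) P⇒Q = +-mono-≤ (bit-mono (P⇒Q (n<1+n n))) (count-mono n (P⇒Q ∘ m<n⇒m<1+n))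

  count-extend : m ≤ n → count m P ≤ count n P
  count-extend {n = zero}          z≤n = z≤n
  count-extend {m} {suc n} {P} m≤1+n with m≤n⇒m<n∨m≡n m≤1+n
  ... | inj₁ (s≤s m≤n) = ≤-trans (count-extend m≤n) (m≤n+m _ (bit (P n)))
  ... | inj₂ refl      = ≤-refl

  count-bounded : ∀ m n → (∀ {i} → P i ≡ true → i < n) → count m P ≤ count n P
  count-bounded zero    n _ = z≤n
  count-bounded {P} (suc m) n P⇒<n with P m in eq
  ... | true  = ≤-trans (≤-reflexive (cong (λ b → bit b + count m P) (sym eq))) (count-extend (P⇒<n eq))
  ... | false = count-bounded m n P⇒<n

  count-⊆ : ∀ m n → (∀ {i} → i < m → P i ≡ true → i < n × Q i ≡ true) → count m P ≤ count n Q
  count-⊆ {P} {Q} m n P⇒Q = begin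
    count m P                       ≤⟨ count-mono m (λ i<m Pi →
                                         let i<n , Qi = P⇒Q i<m Pi in ∧-intro Qi (<ᵇ-complete i<n)) ⟩
    count m (λ i → Q i ∧ (i <ᵇ n))  ≤⟨ count-bounded m n (λ {i} eq → <ᵇ-sound (∧-elimʳ {Q i} eq)) ⟩
    count n (λ i → Q i ∧ (i <ᵇ n))  ≤⟨ count-mono n (λ _ → ∧-elimˡ) ⟩
    count n Q                       ∎
    where open ≤-Reasoning

  count-∅ : ∀ n → (∀ {i} → i < n → P i ≡ false) → count n P ≡ 0
  count-∅ n P⇒⊥ = n≤0⇒n≡0 (count-⊆ {Q = λ _ → true} n 0 λ i<n Pi → ⊥-elim (true≢false Pi (P⇒⊥ i<n)))

  count-+-mono : ∀ n → (∀ i → bit (P i) + bit (Q i) ≤ bit (R i) + bit (S i)) →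
                 count n P + count n Q ≤ count n R + count n S
  count-+-mono zero    _ = z≤n
  count-+-mono {P} {Q} {R} {S} (suc n) h = begin
    (bit (P n) + count n P) + (bit (Q n) + count n Q)  ≡⟨ interchange (bit (P n)) _ _ _ ⟩
    (bit (P n) + bit (Q n)) + (count n P + count n Q)  ≤⟨ +-mono-≤ (h n) (count-+-mono n h) ⟩
    (bit (R n) + bit (S n)) + (count n R + count n S)  ≡⟨ interchange (bit (R n)) _ _ _ ⟩
    (bit (R n) + count n R) + (bit (S n) + count n S)  ∎
    where open ≤-Reasoning

  count-∪ : ∀ n → count n (λ i → P i ∨ Q i) ≤ count n P + count n Q
  count-∪ {P} {Q} n = begin
    count n (λ i → P i ∨ Q i)                            ≤⟨ m≤m+n _ _ ⟩
    count n (λ i → P i ∨ Q i) + count n (λ i → P i ∧ Q i) ≤⟨ count-+-mono n (λ i → pointwise (P i) (Q i)) ⟩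
    count n P + count n Q                                ∎
    where
    open ≤-Reasoning
    pointwise : ∀ a b → bit (a ∨ b) + bit (a ∧ b) ≤ bit a + bit b
    pointwise false b     = ≤-reflexive (+-identityʳ (bit b))
    pointwise true  _     = ≤-refl

  count-⊎ : ∀ n → (∀ {i} → P i ≡ true → R i ≡ true) → (∀ {i} → Q i ≡ true → R i ≡ true) →
            (∀ {i} → P i ≡ true → Q i ≡ true → ⊥) → count n P + count n Q ≤ count n R
  count-⊎ {P} {R} {Q} n P⇒R Q⇒R disjoint = begin
    count n P + count n Q               ≤⟨ count-+-mono n (λ i → pointwise P⇒R Q⇒R disjoint) ⟩
    count n R + count n (λ _ → false)   ≡⟨ cong (count n R +_) (count-∅ n λ _ → refl) ⟩
    count n R + 0                       ≡⟨ +-identityʳ _ ⟩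
    count n R                           ∎
    where
    open ≤-Reasoning
    pointwise : ∀ {a b c} → (a ≡ true → c ≡ true) → (b ≡ true → c ≡ true) →
                (a ≡ true → b ≡ true → ⊥) → bit a + bit b ≤ bit c + 0
    pointwise {false} {b} {c} _ b⇒c _ = ≤-trans (bit-mono b⇒c) (m≤m+n _ 0)
    pointwise {true} {false} a⇒c _ _ rewrite a⇒c refl = ≤-refl
    pointwise {true} {true} _ _ dis = ⊥-elim (dis refl refl)

  count-≡ : ∀ n → count n (_≡ᵇ i) ≤ 1
  count-≡ zero = z≤n
  count-≡ {i} (suc n) with n ≡ᵇ i in eq
  ... | false = count-≡ n
  ... | true  = ≤-reflexive (cong suc (count-∅ n λ j<n →
        ¬-not λ j≡i → <-irrefl (trans (≡ᵇ-sound j≡i) (sym (≡ᵇ-sound {n} eq))) j<n))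

  count-pos : i < n → P i ≡ true → 1 ≤ count n P
  count-pos {i} {P = P} i<n Pi = ≤-trans
    (≤-trans (≤-reflexive (cong bit (sym Pi))) (m≤m+n _ (count i P))) (count-extend i<n)

  count-strict : i < n → P i ≡ true → count i P < count n P
  count-strict {i} {P = P} i<n Pi =
    ≤-trans (≤-reflexive (cong (λ b → bit b + count i P) (sym Pi))) (count-extend i<n)

  -- Induction on `m`: the last value `f m` is taken out of `P`, and injectivity keeps the other
  -- values away from it.
  count-injection : (f : ℕ → ℕ) → (∀ {j k} → j < m → k < m → f j ≡ f k → j ≡ k) →
                    (∀ {j} → j < m → f j < n × P (f j) ≡ true) → m ≤ count n P
  count-injection {zero} f inj f∈P = z≤n
  count-injection {suc m} {n} {P} f inj f∈P = begin
    suc m                                ≡⟨ +-comm 1 m ⟩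
    m + 1                                ≤⟨ +-mono-≤
      (count-injection {m} {n} {λ i → P i ∧ not (i ≡ᵇ f m)} f
        (λ j<m k<m → inj (m<n⇒m<1+n j<m) (m<n⇒m<1+n k<m))
        λ {j} j<m → let fj<n , Pfj = f∈P (m<n⇒m<1+n j<m) in
          fj<n , ∧-intro Pfj (cong not (¬-not λ eq →
            <-irrefl (inj (m<n⇒m<1+n j<m) (n<1+n m) (≡ᵇ-sound eq)) j<m)))
      (count-pos (proj₁ (f∈P (n<1+n m))) (≡ᵇ-complete {f m} refl)) ⟩
    count n (λ i → P i ∧ not (i ≡ᵇ f m)) + count n (_≡ᵇ f m)
                                         ≤⟨ count-⊎ n ∧-elimˡ
      (λ {i} eq → trans (cong P (≡ᵇ-sound eq)) (proj₂ (f∈P (n<1+n m))))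
      (λ {i} eq₁ eq₂ → true≢false eq₂ (not-elim (∧-elimʳ {P i} eq₁))) ⟩
    count n P                            ∎
    where open ≤-Reasoning

  -- Elements are addressed by rank: exactly `m` elements of `P` lie below the witness. In the
  -- forest this rank is the `index` that decides the colour of a child.
  pick : m < count n P → ∃[ i ] i < n × P i ≡ true × count i P ≡ m
  pick {m} {suc n} {P} m<count with P n in eq
  ... | false = let i , i<n , p = pick m<count in i , m<n⇒m<1+n i<n , p
  ... | true with m ≟ count n P
  ... | yes refl = n , n<1+n n , eq , refl
  ... | no m≢    = let i , i<n , p = pick (≤∧≢⇒< (≤-pred m<count) m≢) in i , m<n⇒m<1+n i<n , p

  -- The value is n if P fails below n.
  least : ℕ → (ℕ → Bool) → ℕ
  least zero    P = 0
  least (suc n) P = if P (least n P) then least n P else suc (least n P)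

  least-minimal : ∀ n → j < least n P → P j ≡ false
  least-minimal {P = P} (suc n) j< with P (least n P) in eq
  ... | true = least-minimal n j<
  ... | false with m<1+n⇒m<n∨m≡n j<
  ... | inj₁ j<′  = least-minimal n j<′
  ... | inj₂ refl = eq

  least-dichotomy : ∀ n P → P (least n P) ≡ true ⊎ least n P ≡ n
  least-dichotomy zero    P = inj₂ refl
  least-dichotomy (suc n) P with P (least n P) in eq | least-dichotomy n P
  ... | true  | _       = inj₁ eq
  ... | false | inj₂ l≡n = inj₂ (cong suc l≡n)

  least-found : i < n → P i ≡ true → P (least n P) ≡ true
  least-found {i} {n} {P} i<n Pi with least-dichotomy n P
  ... | inj₁ found = found
  ... | inj₂ l≡n   = ⊥-elim (true≢false Pi (least-minimal n (subst (i <_) (sym l≡n) i<n)))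

  module _ {N : ℕ} {h : Vec ℕ N → ℕ} {P : Vec ℕ (suc N) → Bool} where

    any-rec : Recursive h → RecursiveP P → RecursiveP (λ xs → any (h xs) (λ i → P (i ∷ xs)))
    any-rec rh rP = recursiveP
      (primrec (λ k xs → bit (any k (λ i → P (i ∷ xs))))
        {λ ys → bit (P (Vec.head ys ∷ Vec.tail (Vec.tail ys))) ⊔ Vec.head (Vec.tail ys)}
        (const-rec 0)
        (⊔-rec (drop₂ (rec rP)) (Recursive-cong (λ { (_ ∷ _ ∷ _) → refl }) (var 1F)))
        (λ k xs → bit-∨ (P (k ∷ xs)) _) rh)
      where
      bit-∨ : ∀ a b → bit a ⊔ bit b ≡ bit (a ∨ b)
      bit-∨ false b     = refl
      bit-∨ true  false = refl
      bit-∨ true  true  = refl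

    count-rec : Recursive h → RecursiveP P → Recursive (λ xs → count (h xs) (λ i → P (i ∷ xs)))
    count-rec rh rP =
      primrec (λ k xs → count k (λ i → P (i ∷ xs)))
        {λ ys → bit (P (Vec.head ys ∷ Vec.tail (Vec.tail ys))) + Vec.head (Vec.tail ys)}
        (const-rec 0)
        (+-rec (drop₂ (rec rP)) (Recursive-cong (λ { (_ ∷ _ ∷ _) → refl }) (var 1F)))
        (λ _ _ → refl) rh

    least-rec : Recursive h → RecursiveP P → Recursive (λ xs → least (h xs) (λ i → P (i ∷ xs)))
    least-rec rh rP =
      primrec (λ k xs → least k (λ i → P (i ∷ xs)))
        {λ ys → if P (Vec.tail ys) then Vec.head (Vec.tail ys) else suc (Vec.head (Vec.tail ys))}
        (const-rec 0)
        (if-rec (recursiveP (tail-rec (rec rP)))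
          (Recursive-cong (λ { (_ ∷ _ ∷ _) → refl }) (var 1F))
          (suc-rec (Recursive-cong (λ { (_ ∷ _ ∷ _) → refl }) (var 1F))))
        (λ _ _ → refl) rh

open Counting

-- Cardinalities, finite sets as numbers, course-of-values recursion

module FiniteSets where

  private
    variable
      i j k m n : ℕ
      P Q R S : ℕ → Bool

  members : ℕ → (ℕ → Bool) → List ℕ
  members zero    P = []
  members (suc n) P = if P n then n ∷ members n P else members n P

  ∈-members⁺ : i < n → P i ≡ true → i List.∈ members n P
  ∈-members⁺ {i} {suc n} {P} i<1+n Pi with m<1+n⇒m<n∨m≡n i<1+n
  ... | inj₂ refl rewrite Pi = here refl
  ... | inj₁ i<n with P n
  ... | true  = there (∈-members⁺ i<n Pi)
  ... | false = ∈-members⁺ i<n Pi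

  ∈-members⁻ : ∀ n → i List.∈ members n P → i < n × P i ≡ true
  ∈-members⁻ {P = P} (suc n) i∈ with P n in eq
  ... | false = let i<n , Pi = ∈-members⁻ n i∈ in m<n⇒m<1+n i<n , Pi
  ... | true with i∈
  ... | here refl = n<1+n n , eq
  ... | there i∈′ = let i<n , Pi = ∈-members⁻ n i∈′ in m<n⇒m<1+n i<n , Pi

  members-unique : ∀ n P → Unique (members n P)
  members-unique zero    P = []
  members-unique (suc n) P with P n
  ... | false = members-unique n P
  ... | true  = All.tabulate (λ i∈ n≡i → <-irrefl (sym n≡i) (proj₁ (∈-members⁻ n i∈))) ∷ members-unique n P

  length-members : ∀ n P → length (members n P) ≡ count n P
  length-members zero    P = refl
  length-members (suc n) P with P n
  ... | false = length-members n P
  ... | true  = cong suc (length-members n P)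

  hasSize-count : ∀ {A : Pred ℕ 0ℓ} → (∀ {i} → A i → i < n × P i ≡ true) →
                  (∀ {i} → P i ≡ true → A i) → HasSize A (count n P)
  hasSize-count {n} {P} A⇒P P⇒A =
    members n P , members-unique n P , length-members n P ,
    (λ a → let i<n , Pi = A⇒P a in ∈-members⁺ i<n Pi) , λ i∈ → P⇒A (proj₂ (∈-members⁻ n i∈))

  -- Duplicate-free listings of one set are permutations of each other. This ties `count` to
  -- whatever listing a `HasSize` supplies.
  hasSize-unique : ∀ {A : Pred ℕ 0ℓ} → HasSize A m → HasSize A n → m ≡ n
  hasSize-unique (xs , xs! , refl , A⊆xs , xs⊆A) (ys , ys! , refl , A⊆ys , ys⊆A) =
    ↭-length (∼bag⇒↭ (unique∧set⇒bag xs! ys! (mk⇔ (A⊆ys ∘ xs⊆A) (A⊆xs ∘ ys⊆A))))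

  -- Finite sets coded by binary expansions

  iter : (ℕ → ℕ) → ℕ → ℕ → ℕ
  iter f zero    x = x
  iter f (suc k) x = f (iter f k x)

  iter-shift : ∀ f k x → iter f k (f x) ≡ f (iter f k x)
  iter-shift f zero    x = refl
  iter-shift f (suc k) x = cong f (iter-shift f k x)

  iter-+ : ∀ f j k x → iter f (j + k) x ≡ iter f j (iter f k x)
  iter-+ f zero    k x = refl
  iter-+ f (suc j) k x = cong f (iter-+ f j k x)

  odd : ℕ → Bool
  odd zero    = false
  odd (suc n) = not (odd n)

  half : ℕ → ℕ
  half zero    = 0
  half (suc n) = bit (odd n) + half n

  mem : ℕ → ℕ → Bool
  mem i S = odd (iter half i S)

  mem-suc : ∀ i S → mem (suc i) S ≡ mem i (half S)
  mem-suc i S = cong odd (sym (iter-shift half i S))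

  odd-+2* : ∀ m k → odd (m + 2 * k) ≡ odd m
  odd-+2* m zero    = cong odd (+-identityʳ m)
  odd-+2* m (suc k) = begin
    odd (m + 2 * suc k)        ≡⟨ cong (λ t → odd (m + t)) (*-suc 2 k) ⟩
    odd (m + (2 + 2 * k))      ≡⟨ cong odd (trans (+-suc m _) (cong suc (+-suc m _))) ⟩
    not (not (odd (m + 2 * k))) ≡⟨ not-involutive _ ⟩
    odd (m + 2 * k)            ≡⟨ odd-+2* m k ⟩
    odd m                      ∎
    where open ≡-Reasoning

  half-2+ : ∀ m → half (2 + m) ≡ suc (half m)
  half-2+ m with odd m
  ... | false = refl
  ... | true  = refl

  half-+2* : ∀ m k → half (m + 2 * k) ≡ half m + k
  half-+2* m zero    = trans (cong half (+-identityʳ m)) (sym (+-identityʳ (half m)))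
  half-+2* m (suc k) = begin
    half (m + 2 * suc k)    ≡⟨ cong (λ t → half (m + t)) (*-suc 2 k) ⟩
    half (m + (2 + 2 * k))  ≡⟨ cong half (trans (+-suc m _) (cong suc (+-suc m _))) ⟩
    half (2 + (m + 2 * k))  ≡⟨ half-2+ (m + 2 * k) ⟩
    suc (half (m + 2 * k))  ≡⟨ cong suc (half-+2* m k) ⟩
    suc (half m + k)        ≡⟨ +-suc (half m) k ⟨
    half m + suc k          ∎
    where open ≡-Reasoning

  encode : ℕ → (ℕ → Bool) → ℕ
  encode zero    F = 0
  encode (suc n) F = bit (F 0) + 2 * encode n (F ∘ suc)

  encode-< : ∀ n F → encode n F < 2 ^ n
  encode-< zero    F = ≤-refl
  encode-< (suc n) F = begin-strict
    bit (F 0) + 2 * encode n (F ∘ suc)  <⟨ +-monoˡ-< _ (bit<2 (F 0)) ⟩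
    2 + 2 * encode n (F ∘ suc)          ≡⟨ *-suc 2 (encode n (F ∘ suc)) ⟨
    2 * suc (encode n (F ∘ suc))        ≤⟨ *-monoʳ-≤ 2 (encode-< n (F ∘ suc)) ⟩
    2 * 2 ^ n                           ∎
    where
    open ≤-Reasoning
    bit<2 : ∀ b → bit b < 2
    bit<2 false = s≤s z≤n
    bit<2 true  = s≤s (s≤s z≤n)

  mem-encode : ∀ n F → i < n → mem i (encode n F) ≡ F i
  mem-encode {zero} (suc n) F _ = trans (odd-+2* (bit (F 0)) (encode n (F ∘ suc))) (odd-bit (F 0))
    where
    odd-bit : ∀ b → odd (bit b) ≡ b
    odd-bit false = refl
    odd-bit true  = refl
  mem-encode {suc i} (suc n) F (s≤s i<n) = begin
    mem (suc i) (encode (suc n) F)  ≡⟨ mem-suc i _ ⟩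
    mem i (half (encode (suc n) F)) ≡⟨ cong (mem i) (half-+2* (bit (F 0)) (encode n (F ∘ suc))) ⟩
    mem i (half (bit (F 0)) + encode n (F ∘ suc)) ≡⟨ cong (λ t → mem i (t + encode n (F ∘ suc))) (half-bit (F 0)) ⟩
    mem i (encode n (F ∘ suc))      ≡⟨ mem-encode n (F ∘ suc) i<n ⟩
    F (suc i)                       ∎
    where
    open ≡-Reasoning
    half-bit : ∀ b → half (bit b) ≡ 0
    half-bit false = refl
    half-bit true  = refl

  -- Digit `y` of `S` is 0, so the addition causes no carry.
  mem-+2^ : ∀ i y S → mem y S ≡ false → mem i (S + 2 ^ y) ≡ mem i S ∨ (i ≡ᵇ y)
  mem-+2^ zero zero S y∉S rewrite +-comm S 1 | y∉S = refl
  mem-+2^ (suc i) zero S y∉S = begin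
    mem (suc i) (S + 1)     ≡⟨ cong (mem (suc i)) (+-comm S 1) ⟩
    mem (suc i) (suc S)     ≡⟨ mem-suc i (suc S) ⟩
    mem i (bit (odd S) + half S) ≡⟨ cong (λ b → mem i (bit b + half S)) y∉S ⟩
    mem i (half S)          ≡⟨ mem-suc i S ⟨
    mem (suc i) S           ≡⟨ ∨-identityʳ _ ⟨
    mem (suc i) S ∨ false   ∎
    where open ≡-Reasoning
  mem-+2^ zero (suc y) S y∉S = trans (odd-+2* S (2 ^ y)) (sym (∨-identityʳ (odd S)))
  mem-+2^ (suc i) (suc y) S y∉S = begin
    mem (suc i) (S + 2 ^ suc y)   ≡⟨ mem-suc i _ ⟩
    mem i (half (S + 2 ^ suc y))  ≡⟨ cong (mem i) (half-+2* S (2 ^ y)) ⟩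
    mem i (half S + 2 ^ y)        ≡⟨ mem-+2^ i y (half S) (trans (sym (mem-suc y S)) y∉S) ⟩
    mem i (half S) ∨ (i ≡ᵇ y)     ≡⟨ cong (_∨ (i ≡ᵇ y)) (mem-suc i S) ⟨
    mem (suc i) S ∨ (i ≡ᵇ y)      ∎
    where open ≡-Reasoning

  insert : ℕ → ℕ → ℕ
  insert y S = if mem y S then S else S + 2 ^ y

  mem-insert : ∀ i y S → mem i (insert y S) ≡ mem i S ∨ (i ≡ᵇ y)
  mem-insert i y S with mem y S in eq
  ... | false = mem-+2^ i y S eq
  ... | true with i ≡ᵇ y in i≡y
  ... | false = sym (∨-identityʳ _)
  ... | true  = trans (trans (cong (λ t → mem t S) (≡ᵇ-sound {i} i≡y)) eq) (sym (∨-zeroʳ _))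

  iter-rec : (f : ℕ → ℕ) {g h : Vec ℕ n → ℕ} → Recursive {1} (λ xs → f (lookup xs 0F)) →
             Recursive g → Recursive h → Recursive (λ xs → iter f (g xs) (h xs))
  iter-rec f rf rg rh = app₂ {f = λ xs → iter f (lookup xs 0F) (lookup xs 1F)}
    (primrec (λ k xs → iter f k (lookup xs 1F)) (var 1F) (app₁ rf (var 1F)) (λ _ _ → refl) (var 0F))
    rg rh

  odd-rec : {f : Vec ℕ n → ℕ} → Recursive f → RecursiveP (λ xs → odd (f xs))
  odd-rec rf = recursiveP (app₁ {f = λ xs → bit (odd (lookup xs 0F))}
    (primrec (λ k _ → bit (odd k)) (const-rec 0) (∸-rec (const-rec 1) (var 1F))
      (λ k _ → eq (odd k)) (var 0F)) rf)
    where
    eq : ∀ b → 1 ∸ bit b ≡ bit (not b)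
    eq false = refl
    eq true  = refl

  half-rec : Recursive {1} (λ xs → half (lookup xs 0F))
  half-rec = primrec (λ k _ → half k) (const-rec 0) (+-rec (rec (odd-rec (var 0F))) (var 1F))
    (λ _ _ → refl) (var 0F)

  module _ {N : ℕ} {f g : Vec ℕ N → ℕ} where

    mem-rec : Recursive f → Recursive g → RecursiveP (λ xs → mem (f xs) (g xs))
    mem-rec rf rg = odd-rec (iter-rec half half-rec rf rg)

    insert-rec : Recursive f → Recursive g → Recursive (λ xs → insert (f xs) (g xs))
    insert-rec rf rg = if-rec (mem-rec rf rg) rg (+-rec rg (2^-rec rf))

  -- Sequences defined by course-of-values recursion on the set of earlier values.
  module History (φ : ℕ → ℕ → ℕ) where

    history : ℕ → ℕ
    history zero    = 0
    history (suc n) = insert (φ n (history n)) (history n)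

    value : ℕ → ℕ
    value n = φ n (history n)

    mem-zero : ∀ i → mem i 0 ≡ false
    mem-zero zero    = refl
    mem-zero (suc i) = trans (mem-suc i 0) (mem-zero i)

    value-∈ : m < n → mem (value m) (history n) ≡ true
    value-∈ {m} {suc n} m<1+n rewrite mem-insert (value m) (value n) (history n)
      with m<1+n⇒m<n∨m≡n m<1+n
    ... | inj₁ m<n  = ∨-introˡ (value-∈ m<n)
    ... | inj₂ refl = ∨-introʳ {mem (value m) (history m)} (≡ᵇ-complete {value m} refl)

    ∈-value : ∀ i n → mem i (history n) ≡ true → ∃[ m ] m < n × value m ≡ i
    ∈-value i zero i∈ = ⊥-elim (true≢false i∈ (mem-zero i))
    ∈-value i (suc n) i∈
      with ∨-elim {mem i (history n)} (trans (sym (mem-insert i (value n) (history n))) i∈)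
    ... | inj₁ i∈′ = let m , m<n , eq = ∈-value i n i∈′ in m , m<n⇒m<1+n m<n , eq
    ... | inj₂ i≡  = n , n<1+n n , sym (≡ᵇ-sound i≡)

    count-history : ∀ m n → count m (λ i → mem i (history n)) ≤ n
    count-history m zero    = ≤-reflexive (count-∅ m λ {i} _ → mem-zero i)
    count-history m (suc n) = begin
      count m (λ i → mem i (history (suc n)))
        ≤⟨ count-mono m (λ {i} _ → trans (sym (mem-insert i (value n) (history n)))) ⟩
      count m (λ i → mem i (history n) ∨ (i ≡ᵇ value n))
        ≤⟨ count-∪ m ⟩
      count m (λ i → mem i (history n)) + count m (_≡ᵇ value n)
        ≤⟨ +-mono-≤ (count-history m n) (count-≡ m) ⟩
      n + 1
        ≡⟨ +-comm n 1 ⟩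
      suc n ∎
      where open ≤-Reasoning

    module _ (φ-rec : Recursive {2} (λ xs → φ (lookup xs 0F) (lookup xs 1F)))
             {N : ℕ} {f : Vec ℕ N → ℕ} where

      history-rec : Recursive f → Recursive (λ xs → history (f xs))
      history-rec rf = primrec (λ k _ → history k) (const-rec 0)
        (insert-rec (app₂ φ-rec (var 0F) (var 1F)) (var 1F)) (λ _ _ → refl) rf

      value-rec : Recursive f → Recursive (λ xs → value (f xs))
      value-rec rf = app₂ φ-rec rf (history-rec rf)

open FiniteSets

-- A computable marriage theorem for graphs with slack

neighbours : (ℕ → ℕ → Bool) → (ℕ → ℕ) → (ℕ → Bool) → ℕ → Bool
neighbours G bwd F z = any (bwd (suc z)) λ x → F x ∧ G x z

module Matching
  (G : ℕ → ℕ → Bool) (fwd bwd : ℕ → ℕ)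
  (fwd-bound : ∀ {x z m} → G x z ≡ true → x < m → z < fwd m)
  (bwd-bound : ∀ {x z n} → G x z ≡ true → z < n → x < bwd n)
  (expansion : ∀ M F → (∀ {x} → F x ≡ true → x < M) →
               6 * count M F ≤ 5 * count (fwd M) (neighbours G bwd F))
  where

  private
    variable
      k m n x y z : ℕ
      F T : ℕ → Bool

  N : (ℕ → Bool) → ℕ → Bool
  N = neighbours G bwd

  N-intro : F x ≡ true → G x z ≡ true → N F z ≡ true
  N-intro Fx Gxz = any-intro (bwd-bound Gxz (n<1+n _)) (∧-intro Fx Gxz)

  N-elim : N F z ≡ true → ∃[ x ] F x ≡ true × G x z ≡ true
  N-elim {F} {z} eq = let x , _ , p = any-elim {bwd (suc z)} eq in x , ∧-elimˡ p , ∧-elimʳ {F x} p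

  free : (ℕ → Bool) → ℕ → ℕ → Bool
  free F U z = N F z ∧ not (mem z U)

  free-intro : ∀ U → N F z ≡ true → mem z U ≡ false → free F U z ≡ true
  free-intro U NFz z∉U = ∧-intro NFz (cong not z∉U)

  free-elim : ∀ F U → free F U z ≡ true → N F z ≡ true × mem z U ≡ false
  free-elim {z} F U eq = ∧-elimˡ eq , not-elim (∧-elimʳ {N F z} eq)

  Supported : ℕ → ℕ → (ℕ → Bool) → Set
  Supported m n F = ∀ {x} → F x ≡ true → m ≤ x × x < n

  -- The invariant of the construction: Hall's condition for what is left at stage `t`, when the
  -- points from `t` on still lack a partner and the members of `U` have been handed out.
  Hall : ℕ → ℕ → Set
  Hall t U = ∀ M F → Supported t M F → count M F ≤ count (fwd M) (free F U)

  -- Points from `layer t (suc r)` on share no neighbour with points below `layer t r`, and points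
  -- from `layer t 0` on are not adjacent to any partner of a point up to `t`.
  layer : ℕ → ℕ → ℕ
  layer t zero    = suc t ⊔ bwd (fwd (suc t))
  layer t (suc r) = layer t r ⊔ bwd (fwd (layer t r))

  -- A deficient set of fewer than 5 (t + 1) points misses one of the bands between
  -- consecutive layers; its part below that band is deficient as well.  Hence it
  -- suffices to test the sets below the last layer.
  top : ℕ → ℕ
  top t = layer t (5 * suc t)

  -- The coded set is cut down to the admissible points, so that every number codes a legitimate
  -- test set.
  decode : ℕ → ℕ → ℕ → Bool
  decode t k x = mem x k ∧ ((t <ᵇ x) ∧ (x <ᵇ top t))

  freeExcept : ℕ → ℕ → (ℕ → Bool) → ℕ → Bool
  freeExcept U y F z = free F U z ∧ not (z ≡ᵇ y)

  deficient : ℕ → ℕ → ℕ → ℕ → Bool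
  deficient t U y k = count (fwd (top t)) (freeExcept U y (decode t k)) <ᵇ count (top t) (decode t k)

  good : ℕ → ℕ → ℕ → Bool
  good t U y = (G t y ∧ not (mem y U)) ∧ not (any (2 ^ top t) (deficient t U y))

  choose : ℕ → ℕ → ℕ
  choose t U = least (fwd (suc t)) (good t U)

  open History choose public renaming (value to match)

  good-G : good m k y ≡ true → G m y ≡ true
  good-G eq = ∧-elimˡ (∧-elimˡ eq)

  good-∉ : ∀ t U → good t U y ≡ true → mem y U ≡ false
  good-∉ {y} t U eq = not-elim (∧-elimʳ {G t y} (∧-elimˡ eq))

  layer-mono : ∀ t → m ≤ n → layer t m ≤ layer t n
  layer-mono {n = zero} t z≤n = ≤-refl
  layer-mono {m} {suc n} t m≤1+n with m≤n⇒m<n∨m≡n m≤1+n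
  ... | inj₁ (s≤s m≤n) = ≤-trans (layer-mono t m≤n) (m≤m⊔n _ _)
  ... | inj₂ refl      = ≤-refl

  module Existence (t U : ℕ) (hall : Hall t U) where

    M B : ℕ
    M = top t
    B = fwd M

    t<M : t < M
    t<M = ≤-trans (m≤m⊔n (suc t) (bwd (fwd (suc t)))) (layer-mono {0} {5 * suc t} t z≤n)

    -- Under Hall's condition the inequality is an equality: a tight set has no free neighbour to
    -- spare.
    Tight : (ℕ → Bool) → Set
    Tight T = Supported (suc t) M T × count B (free T U) ≤ count M T

    -- Counting free neighbours is submodular and counting points is modular.
    tight-∪ : Tight T → Tight F → Tight (λ x → T x ∨ F x)
    tight-∪ {T} {F} (suppT , tightT) (suppF , tightF) =
      (λ {x} eq → case (∨-elim {T x} eq)) , +-cancelʳ-≤ (count M T∩F) _ _ (begin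
        count B (free T∪F U) + count M T∩F
          ≤⟨ +-monoʳ-≤ (count B (free T∪F U)) (hall M T∩F λ eq →
               let t<x , x<M = suppT (∧-elimˡ eq) in <⇒≤ t<x , x<M) ⟩
        count B (free T∪F U) + count B (free T∩F U)
          ≤⟨ count-+-mono B (λ z → submodular free-∪ free-∩ˡ free-∩ʳ) ⟩
        count B (free T U) + count B (free F U)
          ≤⟨ +-mono-≤ tightT tightF ⟩
        count M T + count M F
          ≤⟨ count-+-mono M (λ x → modular (T x) (F x)) ⟩
        count M T∪F + count M T∩F ∎)
      where
      open ≤-Reasoning
      T∪F T∩F : ℕ → Bool
      T∪F x = T x ∨ F x
      T∩F x = T x ∧ F x

      case : T x ≡ true ⊎ F x ≡ true → suc t ≤ x × x < M
      case (inj₁ Tx) = suppT Tx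
      case (inj₂ Fx) = suppF Fx

      free-∪ : free T∪F U z ≡ true → free T U z ≡ true ⊎ free F U z ≡ true
      free-∪ eq with free-elim T∪F U eq
      ... | Nz , z∉U with N-elim Nz
      ... | x , T∪Fx , Gxz with ∨-elim {T x} T∪Fx
      ... | inj₁ Tx = inj₁ (free-intro U (N-intro Tx Gxz) z∉U)
      ... | inj₂ Fx = inj₂ (free-intro U (N-intro Fx Gxz) z∉U)

      free-∩ˡ : free T∩F U z ≡ true → free T U z ≡ true
      free-∩ˡ eq with free-elim T∩F U eq
      ... | Nz , z∉U with N-elim Nz
      ... | x , T∩Fx , Gxz = free-intro U (N-intro (∧-elimˡ T∩Fx) Gxz) z∉U

      free-∩ʳ : free T∩F U z ≡ true → free F U z ≡ true
      free-∩ʳ eq with free-elim T∩F U eq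
      ... | Nz , z∉U with N-elim Nz
      ... | x , T∩Fx , Gxz = free-intro U (N-intro (∧-elimʳ {T x} T∩Fx) Gxz) z∉U

      submodular : ∀ {a b c d} → (a ≡ true → c ≡ true ⊎ d ≡ true) →
                   (b ≡ true → c ≡ true) → (b ≡ true → d ≡ true) → bit a + bit b ≤ bit c + bit d
      submodular {a} {true} {c} {d} _ b⇒c b⇒d rewrite b⇒c refl | b⇒d refl =
        +-monoˡ-≤ 1 (bit-mono {a} {true} λ _ → refl)
      submodular {false} {false} _ _ _ = z≤n
      submodular {true} {false} {c} {d} a⇒ _ _ with a⇒ refl
      ... | inj₁ refl = m≤m+n 1 (bit d)
      ... | inj₂ refl = m≤n+m 1 (bit c)

      modular : ∀ a b → bit a + bit b ≤ bit (a ∨ b) + bit (a ∧ b)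
      modular false b = ≤-reflexive (sym (+-identityʳ (bit b)))
      modular true  b = ≤-refl

    -- Some test set fails once `y` is withheld. Withholding one point costs at most one free
    -- neighbour, so this set is tight.
    obstruction : G t y ≡ true → mem y U ≡ false → ¬ (good t U y ≡ true) →
                  ∃[ F ] Tight F × N F y ≡ true
    obstruction {y} Gty y∉U bad with any (2 ^ M) (deficient t U y) in eq
    ... | false = contradiction (∧-intro (∧-intro Gty (cong not y∉U)) refl) bad
    ... | true with any-elim {2 ^ M} eq
    ... | k , _ , def = D , ((λ {x} → supp {x}) , tight) , y∈ND
      where
      open ≤-Reasoning
      D : ℕ → Bool
      D = decode t k

      supp : Supported (suc t) M D
      supp {x} Dx = let p = ∧-elimʳ {mem x k} Dx in
        <ᵇ-sound (∧-elimˡ p) , <ᵇ-sound (∧-elimʳ {t <ᵇ x} p)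

      def′ : count B (freeExcept U y D) < count M D
      def′ = <ᵇ-sound def

      tight : count B (free D U) ≤ count M D
      tight = begin
        count B (free D U)
          ≤⟨ count-mono B (λ {z} _ → split z) ⟩
        count B (λ z → freeExcept U y D z ∨ (z ≡ᵇ y))
          ≤⟨ count-∪ B ⟩
        count B (freeExcept U y D) + count B (_≡ᵇ y)
          ≤⟨ +-monoʳ-≤ _ (count-≡ B) ⟩
        count B (freeExcept U y D) + 1
          ≡⟨ +-comm _ 1 ⟩
        suc (count B (freeExcept U y D))
          ≤⟨ def′ ⟩
        count M D ∎
        where
        split : ∀ z → free D U z ≡ true → (freeExcept U y D z ∨ (z ≡ᵇ y)) ≡ true
        split z eq with z ≡ᵇ y
        ... | true  = ∨-zeroʳ _
        ... | false = ∨-introˡ (∧-intro eq refl)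

      -- Were `y` not adjacent to `D`, withholding it would cost nothing and `D` would already
      -- violate Hall's condition.
      y∈ND : N D y ≡ true
      y∈ND with N D y in Ny
      ... | true  = refl
      ... | false = contradiction (begin-strict
        count B (free D U)          ≤⟨ count-mono B (λ {z} _ eq → ∧-intro eq (cong not (¬-not λ z≡y →
                                         true≢false (∧-elimˡ eq)
                                           (trans (cong (N D) (≡ᵇ-sound {z} z≡y)) Ny)))) ⟩
        count B (freeExcept U y D)  <⟨ def′ ⟩
        count M D                   ≤⟨ hall M D (λ {x} Dx → let t<x , x<M = supp {x} Dx in <⇒≤ t<x , x<M) ⟩
        count B (free D U)          ∎) (<-irrefl refl)

    -- The obstructions at the candidates below `n` are merged one by one, which keeps them tight.
    tight-cover : (∀ y → ¬ (good t U y ≡ true)) → ∀ n →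
                  ∃[ T ] Tight T × (∀ {y} → y < n → G t y ≡ true → mem y U ≡ false → N T y ≡ true)
    tight-cover bad zero = (λ _ → false) , ((λ ()) , (begin
      count B (free (λ _ → false) U)  ≡⟨ count-∅ B (λ {z} _ → cong (_∧ not (mem z U)) (N-∅ z)) ⟩
      0                               ≤⟨ z≤n ⟩
      count M (λ _ → false)           ∎)) , λ ()
      where
      open ≤-Reasoning
      N-∅ : ∀ z → N (λ _ → false) z ≡ false
      N-∅ z = ¬-not λ Nz → case (N-elim Nz)
        where
        case : ∃[ x ] false ≡ true × G x z ≡ true → ⊥
        case ()
    tight-cover bad (suc n) with tight-cover bad n | G t n in Gtn | mem n U in n∈U
    ... | T , tight , cover | false | _ = T , tight , λ {y} y<1+n Gty → cover (≤∧≢⇒< (≤-pred y<1+n) λ { refl → true≢false Gty Gtn }) Gty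
    ... | T , tight , cover | true | true = T , tight , λ {y} y<1+n Gty y∉U → cover (≤∧≢⇒< (≤-pred y<1+n) λ { refl → true≢false n∈U y∉U }) Gty y∉U
    ... | T , tight , cover | true | false with obstruction Gtn n∈U (bad n)
    ... | F , tightF , n∈NF = (λ x → T x ∨ F x) , tight-∪ tight tightF , cover′
      where
      cover′ : ∀ {y} → y < suc n → G t y ≡ true → mem y U ≡ false → N (λ x → T x ∨ F x) y ≡ true
      cover′ y<1+n Gty y∉U with m<1+n⇒m<n∨m≡n y<1+n
      ... | inj₁ y<n = let x , Tx , Gxy = N-elim (cover y<n Gty y∉U) in N-intro (∨-introˡ Tx) Gxy
      ... | inj₂ refl = let x , Fx , Gxy = N-elim n∈NF in N-intro (∨-introʳ {T x} Fx) Gxy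

    -- Adding `t` to a tight set that sees all free neighbours of `t` adds a point but no free
    -- neighbour, against Hall's condition.
    ¬bad : ¬ (∀ y → ¬ (good t U y ≡ true))
    ¬bad bad with tight-cover bad (fwd (suc t))
    ... | T , (supp , tight) , cover = contradiction (begin-strict
      count M T                      <⟨ n<1+n _ ⟩
      suc (count M T)                ≡⟨ +-comm 1 _ ⟩
      count M T + 1                  ≤⟨ +-monoʳ-≤ (count M T) (count-pos t<M (≡ᵇ-complete {t} refl)) ⟩
      count M T + count M (_≡ᵇ t)    ≤⟨ count-⊎ M ∨-introˡ (λ {x} → ∨-introʳ {T x})
                                          (λ {x} Tx x≡t → <-irrefl (sym (≡ᵇ-sound {x} x≡t)) (proj₁ (supp Tx))) ⟩
      count M T′                     ≤⟨ hall M T′ (λ {x} eq → supp′ x (∨-elim {T x} eq)) ⟩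
      count B (free T′ U)            ≤⟨ count-mono B (λ {z} _ → free-T′ z) ⟩
      count B (free T U)             ≤⟨ tight ⟩
      count M T                      ∎) (<-irrefl refl)
      where
      open ≤-Reasoning
      T′ : ℕ → Bool
      T′ x = T x ∨ (x ≡ᵇ t)

      supp′ : ∀ x → T x ≡ true ⊎ (x ≡ᵇ t) ≡ true → t ≤ x × x < M
      supp′ x (inj₁ Tx)  = let t<x , x<M = supp Tx in <⇒≤ t<x , x<M
      supp′ x (inj₂ x≡t) rewrite ≡ᵇ-sound {x} {t} x≡t = ≤-refl , t<M

      free-T′ : ∀ z → free T′ U z ≡ true → free T U z ≡ true
      free-T′ z eq with free-elim T′ U eq
      ... | Nz , z∉U with N-elim Nz
      ... | x , T′x , Gxz with ∨-elim {T x} T′x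
      ... | inj₁ Tx = free-intro U (N-intro Tx Gxz) z∉U
      ... | inj₂ x≡t rewrite ≡ᵇ-sound {x} {t} x≡t =
        free-intro U (cover (fwd-bound Gxz (n<1+n t)) Gxz z∉U) z∉U

    -- `¬bad` is only a refutation; the witness comes from searching below `fwd (suc t)`, where all
    -- neighbours of `t` lie.
    choose-good : good t U (choose t U) ≡ true
    choose-good with any (fwd (suc t)) (good t U) in eq
    ... | true  = let y , y< , gy = any-elim {fwd (suc t)} eq in least-found {P = good t U} y< gy
    ... | false = ⊥-elim (¬bad λ y gy →
      true≢false (any-intro {P = good t U} (fwd-bound (good-G {t} {U} gy) (n<1+n t)) gy) eq)

  open Existence using (choose-good)

  module Preservation (t : ℕ) (match-G : ∀ {m} → m ≤ t → G m (match m) ≡ true)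
                      (good-t : good t (history t) (match t) ≡ true) where

    U U′ y₀ : ℕ
    U  = history t
    U′ = history (suc t)
    y₀ = match t

    U′-bound : mem z U′ ≡ true → z < fwd (suc t)
    U′-bound {z} z∈U′ with ∈-value z (suc t) z∈U′
    ... | m , m<1+t , refl = fwd-bound (match-G (≤-pred m<1+t)) m<1+t

    Gap : (ℕ → Bool) → ℕ → Set
    Gap F r = ∀ {x} → F x ≡ true → x < layer t r ⊎ layer t (suc r) ≤ x

    -- Every band between consecutive layers that `F` meets contributes a point of its own.
    gap : ∀ F r → (∃[ s ] s < r × Gap F s) ⊎ r ≤ count (layer t r) F
    gap F zero    = inj₂ z≤n
    gap F (suc r) with gap F r
    ... | inj₁ (s , s<r , g) = inj₁ (s , m<n⇒m<1+n s<r , λ {x} → g {x})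
    ... | inj₂ r≤ with any (layer t (suc r)) (λ x → F x ∧ not (x <ᵇ layer t r)) in eq
    ... | true = inj₂ (let x , x< , p = any-elim {layer t (suc r)} eq in
      ≤-trans (s≤s (≤-trans r≤ (count-extend {layer t r} {x} {F} (≮⇒≥ λ x<′ →
        true≢false (<ᵇ-complete x<′) (not-elim (∧-elimʳ {F x} p)))))) (count-strict x< (∧-elimˡ p)))
    ... | false = inj₁ (r , n<1+n r , λ {x} → g {x})
      where
      g : Gap F r
      g {x} Fx with x <? layer t r | x <? layer t (suc r)
      ... | yes x< | _      = inj₁ x<
      ... | no _   | no x≮  = inj₂ (≮⇒≥ x≮)
      ... | no x≮  | yes x< = ⊥-elim (true≢false
        (any-intro x< (∧-intro Fx (cong not (¬-not (x≮ ∘ <ᵇ-sound))))) eq)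

    -- The test in `good` ran through all codes below `2 ^ top t`, and `F` has one of them.
    checked : Supported (suc t) (top t) F → count (top t) F ≤ count (fwd (top t)) (freeExcept U y₀ F)
    checked {F} supp = begin
      count M F
        ≤⟨ count-mono M (λ {x} x<M Fx → ∧-intro (trans (mem-encode M F x<M) Fx)
             (∧-intro (<ᵇ-complete (proj₁ (supp Fx))) (<ᵇ-complete x<M))) ⟩
      count M D
        ≤⟨ ≮⇒≥ (λ lt → true≢false (any-intro (encode-< M F) (<ᵇ-complete lt))
             (not-elim (∧-elimʳ {G t y₀ ∧ not (mem y₀ U)} good-t))) ⟩
      count (fwd M) (freeExcept U y₀ D)
        ≤⟨ count-mono (fwd M) (λ {z} _ eq → ∧-intro (free-D z (∧-elimˡ eq)) (∧-elimʳ {free D U z} eq)) ⟩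
      count (fwd M) (freeExcept U y₀ F) ∎
      where
      open ≤-Reasoning
      M : ℕ
      M = top t

      D : ℕ → Bool
      D = decode t (encode M F)

      D⇒F : D x ≡ true → F x ≡ true
      D⇒F {x} Dx = trans (sym (mem-encode M F (<ᵇ-sound (∧-elimʳ {t <ᵇ x} (∧-elimʳ {mem x (encode M F)} Dx)))))
        (∧-elimˡ Dx)

      free-D : ∀ z → free D U z ≡ true → free F U z ≡ true
      free-D z eq with free-elim D U eq
      ... | Nz , z∉U with N-elim Nz
      ... | x , Dx , Gxz = free-intro U (N-intro (D⇒F Dx) Gxz) z∉U

    -- At most `suc t` neighbours have been handed out, and the surplus of a fifth of the size of
    -- `F` pays for them. This is the origin of the threshold `5 * suc t`.
    large : ∀ M F → Supported (suc t) M F → 5 * suc t ≤ count M F → count M F ≤ count (fwd M) (free F U′)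
    large M F supp 5t≤ = *-cancelˡ-≤ 5 (+-cancelˡ-≤ (count M F) _ _ (begin
      c + 5 * c                              ≤⟨ expansion M F (proj₂ ∘ supp) ⟩
      5 * count (fwd M) (N F)                ≤⟨ *-monoʳ-≤ 5 (≤-trans
                                                  (count-mono (fwd M) (λ {z} _ → split z)) (count-∪ (fwd M))) ⟩
      5 * (f + count (fwd M) (λ z → mem z U′)) ≤⟨ *-monoʳ-≤ 5 (+-monoʳ-≤ f (count-history (fwd M) (suc t))) ⟩
      5 * (f + suc t)                        ≡⟨ *-distribˡ-+ 5 f (suc t) ⟩
      5 * f + 5 * suc t                      ≤⟨ +-monoʳ-≤ (5 * f) 5t≤ ⟩
      5 * f + c                              ≡⟨ +-comm (5 * f) c ⟩
      c + 5 * f                              ∎))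
      where
      open ≤-Reasoning
      c f : ℕ
      c = count M F
      f = count (fwd M) (free F U′)

      split : ∀ z → N F z ≡ true → (free F U′ z ∨ mem z U′) ≡ true
      split z eq with mem z U′
      ... | true  = ∨-zeroʳ _
      ... | false = ∨-introˡ (∧-intro eq refl)

    -- The empty band splits `F` into a lower part, which was tested, and an upper part, which is
    -- out of reach of the partners in use. Their neighbourhoods are disjoint, so the two
    -- inequalities add up.
    small : ∀ M F → Supported (suc t) M F → ∀ r → r < 5 * suc t → Gap F r →
            count M F ≤ count (fwd M) (free F U′)
    small M F supp r r< g = begin
      count M F
        ≤⟨ count-mono M (λ {x} _ → split x) ⟩
      count M (λ x → F₁ x ∨ F₂ x)
        ≤⟨ count-∪ M ⟩
      count M F₁ + count M F₂
        ≤⟨ +-mono-≤ below above ⟩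
      count (fwd M) (free F₁ U′) + count (fwd M) (free F₂ U′)
        ≤⟨ count-⊎ (fwd M) (λ {z} → weaken {F₁} ∧-elimˡ z) (λ {z} → weaken {F₂} ∧-elimˡ z) disjoint ⟩
      count (fwd M) (free F U′) ∎
      where
      open ≤-Reasoning
      F₁ F₂ : ℕ → Bool
      F₁ x = F x ∧ (x <ᵇ layer t r)
      F₂ x = F x ∧ not (x <ᵇ layer t r)

      split : ∀ x → F x ≡ true → (F₁ x ∨ F₂ x) ≡ true
      split x Fx rewrite Fx with x <ᵇ layer t r
      ... | true  = refl
      ... | false = refl

      F₁-below : F₁ x ≡ true → x < layer t r
      F₁-below {x} F₁x = <ᵇ-sound (∧-elimʳ {F x} F₁x)

      F₂-above : F₂ x ≡ true → layer t (suc r) ≤ x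
      F₂-above {x} F₂x with g (∧-elimˡ F₂x)
      ... | inj₁ x<   = ⊥-elim (true≢false (<ᵇ-complete x<) (not-elim (∧-elimʳ {F x} F₂x)))
      ... | inj₂ ≤x   = ≤x

      weaken : ∀ {H} → (∀ {x} → H x ≡ true → F x ≡ true) → ∀ z → free H U′ z ≡ true → free F U′ z ≡ true
      weaken {H} H⇒F z eq with free-elim H U′ eq
      ... | Nz , z∉ with N-elim Nz
      ... | x , Hx , Gxz = free-intro U′ (N-intro (H⇒F Hx) Gxz) z∉

      disjoint : free F₁ U′ z ≡ true → free F₂ U′ z ≡ true → ⊥
      disjoint eq₁ eq₂ with N-elim (proj₁ (free-elim F₁ U′ eq₁)) | N-elim (proj₁ (free-elim F₂ U′ eq₂))
      ... | x , F₁x , Gxz | x′ , F₂x′ , Gx′z = <-irrefl refl (begin-strict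
        x′                       <⟨ bwd-bound Gx′z (fwd-bound Gxz (F₁-below F₁x)) ⟩
        bwd (fwd (layer t r))    ≤⟨ m≤n⊔m (layer t r) _ ⟩
        layer t (suc r)          ≤⟨ F₂-above F₂x′ ⟩
        x′                       ∎)

      below : count M F₁ ≤ count (fwd M) (free F₁ U′)
      below = begin
        count M F₁
          ≤⟨ count-bounded M (top t) (λ F₁x → <-≤-trans (F₁-below F₁x) (layer-mono t (<⇒≤ r<))) ⟩
        count (top t) F₁
          ≤⟨ checked (λ F₁x → proj₁ (supp (∧-elimˡ F₁x)) , <-≤-trans (F₁-below F₁x) (layer-mono t (<⇒≤ r<))) ⟩
        count (fwd (top t)) (freeExcept U y₀ F₁)
          ≤⟨ count-⊆ (fwd (top t)) (fwd M) (λ {z} _ → move z) ⟩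
        count (fwd M) (free F₁ U′) ∎
        where
        move : ∀ z → freeExcept U y₀ F₁ z ≡ true → z < fwd M × free F₁ U′ z ≡ true
        move z eq with free-elim F₁ U (∧-elimˡ eq)
        ... | Nz , z∉U with N-elim Nz
        ... | x , F₁x , Gxz = fwd-bound Gxz (proj₂ (supp (∧-elimˡ F₁x))) ,
          free-intro U′ Nz (trans (mem-insert z y₀ U)
            (cong₂ _∨_ z∉U (not-elim (∧-elimʳ {free F₁ U z} eq))))

      -- No neighbour of `F₂` has been handed out, so the expansion applies without loss.
      above : count M F₂ ≤ count (fwd M) (free F₂ U′)
      above = begin
        count M F₂
          ≤⟨ *-cancelˡ-≤ 5 (≤-trans (m≤n+m _ (count M F₂)) (expansion M F₂ (proj₂ ∘ supp ∘ ∧-elimˡ))) ⟩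
        count (fwd M) (N F₂)
          ≤⟨ count-mono (fwd M) (λ {z} _ Nz → free-intro U′ Nz (¬-not λ z∈U′ → far z Nz z∈U′)) ⟩
        count (fwd M) (free F₂ U′) ∎
        where
        far : ∀ z → N F₂ z ≡ true → mem z U′ ≡ true → ⊥
        far z Nz z∈U′ with N-elim Nz
        ... | x , F₂x , Gxz = <-irrefl refl (begin-strict
          x                  <⟨ bwd-bound Gxz (U′-bound z∈U′) ⟩
          bwd (fwd (suc t))  ≤⟨ m≤n⊔m (suc t) _ ⟩
          layer t 0          ≤⟨ layer-mono {0} {suc r} t z≤n ⟩
          layer t (suc r)    ≤⟨ F₂-above F₂x ⟩
          x                  ∎)

    preserve : Hall (suc t) U′
    preserve M F supp with 5 * suc t ≤? count M F
    ... | yes 5t≤ = large M F supp 5t≤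
    ... | no  5t≰ with gap F (5 * suc t)
    ... | inj₁ (r , r< , g) = small M F supp r r< g
    ... | inj₂ ≤c = contradiction (≤-trans ≤c (count-bounded (top t) M (proj₂ ∘ supp))) 5t≰

  -- Invariant and adjacency go through one induction: preserving the invariant uses that the
  -- partners handed out so far are neighbours of their points, which bounds them by `fwd (suc t)`.
  correct : ∀ t → Hall t (history t) × (∀ {m} → m < t → G m (match m) ≡ true)
  correct zero = (λ M F supp → *-cancelˡ-≤ 5 (begin
    5 * count M F                   ≤⟨ m≤n+m _ (count M F) ⟩
    6 * count M F                   ≤⟨ expansion M F (proj₂ ∘ supp) ⟩
    5 * count (fwd M) (N F)         ≤⟨ *-monoʳ-≤ 5 (count-mono (fwd M) λ {z} _ Nz → free-intro 0 Nz (mem-zero z)) ⟩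
    5 * count (fwd M) (free F 0)    ∎)) , λ ()
    where open ≤-Reasoning
  correct (suc t) = Preservation.preserve t (matched ∘ s≤s) good-t , matched
    where
    good-t : good t (history t) (match t) ≡ true
    good-t = choose-good t (history t) (proj₁ (correct t))

    matched : ∀ {m} → m < suc t → G m (match m) ≡ true
    matched m<1+t with m<1+n⇒m<n∨m≡n m<1+t
    ... | inj₁ m<t  = proj₂ (correct t) m<t
    ... | inj₂ refl = good-G {t} {history t} good-t

  match-adjacent : ∀ t → G t (match t) ≡ true
  match-adjacent t = proj₂ (correct (suc t)) (n<1+n t)

  match-≢ : m < n → match m ≢ match n
  match-≢ {m} {n} m<n eq = true≢false (trans (cong (λ y → mem y (history n)) (sym eq)) (value-∈ m<n))
    (good-∉ n (history n) (choose-good n (history n) (proj₁ (correct n))))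

  match-injective : match m ≡ match n → m ≡ n
  match-injective {m} {n} eq with <-cmp m n
  ... | tri< m<n _ _ = contradiction eq (match-≢ m<n)
  ... | tri≈ _ m≡n _ = m≡n
  ... | tri> _ _ n<m = contradiction (sym eq) (match-≢ n<m)

  module _ (G-rec : RecursiveP {2} λ xs → G (lookup xs 0F) (lookup xs 1F))
           (fwd-rec : Recursive {1} λ xs → fwd (lookup xs 0F))
           (bwd-rec : Recursive {1} λ xs → bwd (lookup xs 0F)) where

    layer-rec : ∀ {N} {f g : Vec ℕ N → ℕ} → Recursive f → Recursive g →
                Recursive (λ xs → layer (f xs) (g xs))
    layer-rec rf rg = app₂ {f = λ xs → layer (lookup xs 0F) (lookup xs 1F)}
      (primrec (λ k xs → layer (lookup xs 0F) k)
        (⊔-rec (suc-rec (var 0F)) (app₁ bwd-rec (app₁ fwd-rec (suc-rec (var 0F)))))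
        (⊔-rec (var 1F) (app₁ bwd-rec (app₁ fwd-rec (var 1F))))
        (λ _ _ → refl) (var 1F))
      rf rg

    top-rec : ∀ {N} {f : Vec ℕ N → ℕ} → Recursive f → Recursive (λ xs → top (f xs))
    top-rec rf = layer-rec rf (*-rec (const-rec 5) (suc-rec rf))

    good-rec : RecursiveP {3} λ xs → good (lookup xs 1F) (lookup xs 2F) (lookup xs 0F)
    good-rec = ∧-rec
      (∧-rec (app₂P G-rec (var 1F) (var 0F)) (not-rec (mem-rec (var 0F) (var 2F))))
      (not-rec (any-rec (2^-rec (top-rec (var 1F)))
        (<ᵇ-rec
          (count-rec (app₁ fwd-rec (top-rec (var 2F)))
            (∧-rec
              (∧-rec
                (any-rec (app₁ bwd-rec (suc-rec (var 0F)))
                  (∧-rec (decode-rec (var 4F) (var 2F) (var 0F)) (app₂P G-rec (var 0F) (var 1F))))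
                (not-rec (mem-rec (var 0F) (var 4F))))
              (not-rec (≡ᵇ-rec (var 0F) (var 2F)))))
          (count-rec (top-rec (var 2F)) (decode-rec (var 3F) (var 1F) (var 0F))))))
      where
      decode-rec : ∀ {N} {f g h : Vec ℕ N → ℕ} → Recursive f → Recursive g → Recursive h →
                   RecursiveP (λ xs → decode (f xs) (g xs) (h xs))
      decode-rec rf rg rh =
        ∧-rec (mem-rec rh rg) (∧-rec (<ᵇ-rec rf rh) (<ᵇ-rec rh (top-rec rf)))

    match-rec : ∀ {N} {f : Vec ℕ N → ℕ} → Recursive f → Recursive (λ xs → match (f xs))
    match-rec = value-rec (least-rec (app₁ fwd-rec (suc-rec (var 0F))) good-rec)

-- From a parent function to an edge-coloured forest

iter-periodic : ∀ f {x} d → iter f d x ≡ x → ∀ k → iter f (k * d) x ≡ x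
iter-periodic f d eq zero    = refl
iter-periodic f {x} d eq (suc k) =
  trans (iter-+ f d (k * d) x) (trans (cong (iter f d) (iter-periodic f d eq k)) eq)

-- The i-th element of {0, 1, 2} ∖ {c}, and 3 if there is none.
skip : ℕ → ℕ → ℕ
skip c i = 3 ⊓ (if i <ᵇ c then i else suc i)

3⊓-<3 : ∀ {n} → 3 ⊓ n < 3 → 3 ⊓ n ≡ n
3⊓-<3 {n} lt with ⊓-sel 3 n
... | inj₁ eq = contradiction (subst (_< 3) eq lt) (<-irrefl refl)
... | inj₂ eq = eq

skip-≢ : ∀ {c i} → c < 3 → skip c i ≢ c
skip-≢ {c} {i} c<3 eq = raw (trans (sym (3⊓-<3 (subst (_< 3) (sym eq) c<3))) eq)
  where
  raw : (if i <ᵇ c then i else suc i) ≢ c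
  raw eq with i <ᵇ c in i<c
  ... | true  = <-irrefl eq (<ᵇ-sound {i} {c} i<c)
  ... | false = true≢false (<ᵇ-complete {i} {c} (≤-reflexive eq)) i<c

-- All large indices share the value 3, so only a value below 3 determines its index.
skip-injective : ∀ {c i j} → skip c i < 3 → skip c i ≡ skip c j → i ≡ j
skip-injective {c} {i} {j} lt eq = raw (trans (sym (3⊓-<3 lt)) (trans eq (3⊓-<3 (subst (_< 3) eq lt))))
  where
  raw : (if i <ᵇ c then i else suc i) ≡ (if j <ᵇ c then j else suc j) → i ≡ j
  raw eq with i <ᵇ c in i<c | j <ᵇ c in j<c
  ... | true  | true  = eq
  ... | false | false = suc-injective eq
  ... | true  | false = ⊥-elim (true≢false (<ᵇ-complete {j} {c} (<-trans (≤-reflexive (sym eq)) (<ᵇ-sound {i} {c} i<c))) j<c)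
  ... | false | true  = ⊥-elim (true≢false (<ᵇ-complete {i} {c} (<-trans (≤-reflexive eq) (<ᵇ-sound {j} {c} j<c))) i<c)

-- An index below 3 is always enough, so three kept children serve every vertex, also one of colour
-- 3, whose children must take all three colours.
skip-surjective : ∀ c {d} → d < 3 → d ≢ c → ∃[ i ] i < 3 × skip c i ≡ d
skip-surjective c {d} d<3 d≢c with <-cmp d c
... | tri≈ _ d≡c _ = contradiction d≡c d≢c
... | tri< d<c _ _ = d , d<3 ,
  trans (cong (λ b → 3 ⊓ (if b then d else suc d)) (<ᵇ-complete d<c)) (m≥n⇒m⊓n≡n (<⇒≤ d<3))
skip-surjective c {suc d} 1+d<3 d≢c | tri> _ _ (s≤s c≤d) = d , <-trans (n<1+n d) 1+d<3 ,
  trans (cong (λ b → 3 ⊓ (if b then d else suc d)) (¬-not λ d<c → <⇒≱ (<ᵇ-sound d<c) c≤d))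
    (m≥n⇒m⊓n≡n (<⇒≤ 1+d<3))

module Forest (p bound : ℕ → ℕ) (wide : ∀ w → 5 ≤ count (bound w) λ u → p u ≡ᵇ w) where

  private
    variable
      c i j k u v w : ℕ

  -- Stage n cuts the edge above an ancestor of n, if possible one whose parent lies
  -- above no earlier cut; otherwise the path from n runs into a cycle, and the cut
  -- is made on it.
  rise : ℕ → ℕ → ℕ
  rise n T = least (suc n) λ k → not (mem (iter p (suc k) n) T)

  open History (λ n T → iter p (suc (rise n T)) n)

  cutAt : ℕ → ℕ
  cutAt n = iter p (rise n (history n)) n

  cut : ℕ → Bool
  cut u = any (suc u) λ s → cutAt s ≡ᵇ u

  OnCycle : ℕ → Set
  OnCycle u = ∃[ d ] iter p (suc d) u ≡ u

  -- Both points return after `suc e * suc d` steps, and all of these but the first start from the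
  -- common parent.
  onCycle-unique : OnCycle u → OnCycle v → p u ≡ p v → u ≡ v
  onCycle-unique {u} {v} (d , u-per) (e , v-per) pu≡pv = begin
    u                                    ≡⟨ iter-periodic p (suc d) u-per (suc e) ⟨
    iter p (suc e * suc d) u             ≡⟨ iter-shift p (d + e * suc d) u ⟨
    iter p (d + e * suc d) (p u)         ≡⟨ cong (iter p (d + e * suc d)) pu≡pv ⟩
    iter p (d + e * suc d) (p v)         ≡⟨ iter-shift p (d + e * suc d) v ⟩
    iter p (suc e * suc d) v             ≡⟨ cong (λ k → iter p k v) (*-comm (suc e) (suc d)) ⟩
    iter p (suc d * suc e) v             ≡⟨ iter-periodic p (suc e) v-per (suc d) ⟩
    v                                    ∎
    where open ≡-Reasoning

  -- If all `suc n` inspected ancestors are values of the `n` earlier stages, two of them coincide.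
  -- The default `suc n` of `least` then makes `cutAt n` an ancestor of a repeated point, hence a
  -- point of the cycle.
  cutAt-fresh : ∀ n → mem (value n) (history n) ≡ false ⊎ OnCycle (cutAt n)
  cutAt-fresh n with least-dichotomy (suc n) (λ k → not (mem (iter p (suc k) n) (history n)))
  ... | inj₁ fresh = inj₁ (not-elim fresh)
  ... | inj₂ r≡1+n = inj₂ (cycle (Fin.pigeonhole (n<1+n n) (λ k → Fin.fromℕ< (proj₁ (proj₂ (stamp k))))))
    where
    stamp : (k : Fin (suc n)) → ∃[ s ] s < n × value s ≡ iter p (suc (toℕ k)) n
    stamp k = ∈-value _ n (not-true (least-minimal (suc n) (subst (toℕ k <_) (sym r≡1+n) (Fin.toℕ<n k))))
      where
      not-true : ∀ {b} → not b ≡ false → b ≡ true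
      not-true {true} _ = refl

    cycle : (∃[ i ] ∃[ j ] i Fin.< j × Fin.fromℕ< (proj₁ (proj₂ (stamp i))) ≡ Fin.fromℕ< (proj₁ (proj₂ (stamp j)))) →
            OnCycle (cutAt n)
    cycle (i , j , i<j , eq) = d , (begin
      iter p (suc d) (cutAt n)               ≡⟨ cong (iter p (suc d)) cutAt≡ ⟩
      iter p (suc d) (iter p e x)            ≡⟨ iter-+ p (suc d) e x ⟨
      iter p (suc d + e) x                   ≡⟨ cong (λ k → iter p k x) (+-comm (suc d) e) ⟩
      iter p (e + suc d) x                   ≡⟨ iter-+ p e (suc d) x ⟩
      iter p e (iter p (suc d) x)            ≡⟨ cong (iter p e) periodic ⟩
      iter p e x                             ≡⟨ cutAt≡ ⟨
      cutAt n                                ∎)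
      where
      open ≡-Reasoning
      -- `x` is the first of the two coinciding ancestors, `suc d` the number of steps that lead
      -- from it back to itself, and `e` the number of steps from it to `cutAt n`.
      x d e : ℕ
      x = iter p (suc (toℕ i)) n
      d = toℕ j ∸ suc (toℕ i)
      e = n ∸ toℕ i

      cutAt≡ : cutAt n ≡ iter p e x
      cutAt≡ = begin
        cutAt n                      ≡⟨ cong (λ k → iter p k n) r≡1+n ⟩
        iter p (suc n) n             ≡⟨ cong (λ k → iter p k n) (trans (+-suc e (toℕ i)) (cong suc (m∸n+n≡m (≤-pred (Fin.toℕ<n i))))) ⟨
        iter p (e + suc (toℕ i)) n   ≡⟨ iter-+ p e (suc (toℕ i)) n ⟩
        iter p e x                   ∎

      stamps≡ : proj₁ (stamp i) ≡ proj₁ (stamp j)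
      stamps≡ = trans (sym (Fin.toℕ-fromℕ< _)) (trans (cong toℕ eq) (Fin.toℕ-fromℕ< _))

      periodic : iter p (suc d) x ≡ x
      periodic = begin
        iter p (suc d) x                   ≡⟨ iter-+ p (suc d) (suc (toℕ i)) n ⟨
        iter p (suc d + suc (toℕ i)) n     ≡⟨ cong (λ k → iter p (suc k) n) (m∸n+n≡m i<j) ⟩
        iter p (suc (toℕ j)) n             ≡⟨ proj₂ (proj₂ (stamp j)) ⟨
        value (proj₁ (stamp j))            ≡⟨ cong value stamps≡ ⟨
        value (proj₁ (stamp i))            ≡⟨ proj₂ (proj₂ (stamp i)) ⟩
        x                                  ∎

  cut-stage : cut u ≡ true → ∃[ s ] cutAt s ≡ u
  cut-stage {u} eq = let s , _ , p = any-elim {suc u} eq in s , ≡ᵇ-sound p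

  later-onCycle : ∀ {s t} → s < t → p (cutAt s) ≡ p (cutAt t) → OnCycle (cutAt t)
  later-onCycle {s} {t} s<t eq with cutAt-fresh t
  ... | inj₂ cyc   = cyc
  ... | inj₁ fresh = ⊥-elim (true≢false (trans (cong (λ y → mem y (history t)) (sym eq)) (value-∈ s<t)) fresh)

  -- The later of the two stages cut below a parent that an earlier stage had used, which it does
  -- only on a cycle.
  cut-siblings : cut u ≡ true → cut v ≡ true → p u ≡ p v → u ≢ v → OnCycle u ⊎ OnCycle v
  cut-siblings cu cv pu≡pv u≢v with cut-stage cu | cut-stage cv
  ... | s , refl | t , refl with <-cmp s t
  ... | tri< s<t _ _ = inj₂ (later-onCycle s<t pu≡pv)
  ... | tri≈ _ s≡t _ = contradiction (cong cutAt s≡t) u≢v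
  ... | tri> _ _ t<s = inj₁ (later-onCycle t<s (sym pu≡pv))

  cutChild keptChild : ℕ → ℕ → Bool
  cutChild  w u = (p u ≡ᵇ w) ∧ cut u
  keptChild w u = (p u ≡ᵇ w) ∧ not (cut u)

  -- Each of the three pairs contains a point on a cycle, so at least two of the three siblings are
  -- such points.
  no-three-cut : cutChild w i ≡ true → cutChild w j ≡ true → cutChild w k ≡ true →
                 i < j → j < k → ⊥
  no-three-cut {w} {i} {j} {k} ci cj ck i<j j<k = conclude
    (cut-siblings (∧-elimʳ ci) (∧-elimʳ cj) ij (<⇒≢ i<j))
    (cut-siblings (∧-elimʳ cj) (∧-elimʳ ck) jk (<⇒≢ j<k))
    (cut-siblings (∧-elimʳ ci) (∧-elimʳ ck) (trans ij jk) (<⇒≢ i<k))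
    where
    i<k : i < k
    i<k = <-trans i<j j<k
    parent : ∀ {u} → cutChild w u ≡ true → p u ≡ w
    parent = ≡ᵇ-sound ∘ ∧-elimˡ
    ij : p i ≡ p j
    ij = trans (parent ci) (sym (parent cj))
    jk : p j ≡ p k
    jk = trans (parent cj) (sym (parent ck))
    conclude : OnCycle i ⊎ OnCycle j → OnCycle j ⊎ OnCycle k → OnCycle i ⊎ OnCycle k → ⊥
    conclude (inj₁ oi) (inj₁ oj) _         = <⇒≢ i<j (onCycle-unique oi oj ij)
    conclude (inj₁ oi) (inj₂ ok) _         = <⇒≢ i<k (onCycle-unique oi ok (trans ij jk))
    conclude (inj₂ oj) _         (inj₁ oi) = <⇒≢ i<j (onCycle-unique oi oj ij)
    conclude (inj₂ oj) _         (inj₂ ok) = <⇒≢ j<k (onCycle-unique oj ok jk)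

  cutChild-count : ∀ w → count (bound w) (cutChild w) ≤ 2
  cutChild-count w = ≮⇒≥ λ 2< →
    let k , _ , ck , #k = pick {2} {bound w} {cutChild w} 2<
        j , j<k , cj , #j = pick {1} {k} {cutChild w} (≤-reflexive (sym #k))
        i , i<j , ci , _  = pick {0} {j} {cutChild w} (≤-reflexive (sym #j))
    in no-three-cut {w} {i} {j} {k} ci cj ck i<j j<k

  keptChild-count : ∀ w → 3 ≤ count (bound w) (keptChild w)
  keptChild-count w = +-cancelʳ-≤ 2 3 _ (begin
    5                                                          ≤⟨ wide w ⟩
    count B (λ u → p u ≡ᵇ w)                                   ≤⟨ count-mono B (λ {u} _ → split u) ⟩
    count B (λ u → keptChild w u ∨ cutChild w u)               ≤⟨ count-∪ B ⟩
    count B (keptChild w) + count B (cutChild w)               ≤⟨ +-monoʳ-≤ _ (cutChild-count w) ⟩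
    count B (keptChild w) + 2                                  ∎)
    where
    open ≤-Reasoning
    B : ℕ
    B = bound w
    split : ∀ u → (p u ≡ᵇ w) ≡ true → (keptChild w u ∨ cutChild w u) ≡ true
    split u eq rewrite eq with cut u
    ... | true  = refl
    ... | false = refl

  -- Only the stages up to u count for cut u; so cutAt n may fail to be cut, but only
  -- if it is below n.
  abstract
    rooted : ∀ n → ∃[ k ] cut (iter p k n) ≡ true
    rooted = <-rec (λ n → ∃[ k ] cut (iter p k n) ≡ true) step
      where
      step : ∀ n → (∀ {m} → m < n → ∃[ k ] cut (iter p k m) ≡ true) → ∃[ k ] cut (iter p k n) ≡ true
      step n rec with cutAt n <? n
      ... | no  u≮n = rise n (history n) , any-intro (s≤s (≮⇒≥ u≮n)) (≡ᵇ-complete {cutAt n} refl)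
      ... | yes u<n = let k , eq = rec u<n in
        k + rise n (history n) , trans (cong cut (iter-+ p k (rise n (history n)) n)) eq

  abstract
    depth : ℕ → ℕ
    depth v = least (suc (proj₁ (rooted v))) λ k → cut (iter p k v)

    depth-cut : ∀ v → cut (iter p (depth v) v) ≡ true
    depth-cut v = least-found {proj₁ (rooted v)} {P = λ k → cut (iter p k v)} (n<1+n _) (proj₂ (rooted v))

    depth-least : ∀ v → j < depth v → cut (iter p j v) ≡ false
    depth-least v = least-minimal {P = λ k → cut (iter p k v)} (suc (proj₁ (rooted v)))

  depth-root : cut v ≡ true → depth v ≡ 0
  depth-root {v} cv = n≤0⇒n≡0 (≮⇒≥ λ 0<d → true≢false cv (depth-least v 0<d))

  depth-suc : cut v ≡ false → depth v ≡ suc (depth (p v))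
  depth-suc {v} ¬cv = ≤-antisym
    (≮⇒≥ λ lt → true≢false
      (trans (cong cut (sym (iter-shift p (depth (p v)) v))) (depth-cut (p v)))
      (depth-least v lt))
    (≮⇒≥ λ lt → true≢false (depth-cut v) (below (depth v) lt))
    where
    below : ∀ k → k < suc (depth (p v)) → cut (iter p k v) ≡ false
    below zero    _        = ¬cv
    below (suc k) (s≤s k<) = trans (cong cut (sym (iter-shift p k v))) (depth-least (p v) k<)

  index : ℕ → ℕ
  index u = count u (keptChild (p u))

  -- The colour belongs to the edge from `v` to its parent, and 3 stands for no edge: it marks the
  -- roots and the surplus children, which become roots of the 3-regular forest. The recursion
  -- counts the edges up to the root, because `p` itself offers no decreasing argument.
  colourFrom : ℕ → ℕ → ℕ
  colourFrom zero    v = 3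
  colourFrom (suc k) v = skip (colourFrom k (p v)) (index v)

  colour : ℕ → ℕ
  colour v = colourFrom (depth v) v

  colour-root : cut v ≡ true → colour v ≡ 3
  colour-root {v} cv = cong (λ k → colourFrom k v) (depth-root cv)

  colour-child : cut v ≡ false → colour v ≡ skip (colour (p v)) (index v)
  colour-child {v} ¬cv = cong (λ k → colourFrom k v) (depth-suc ¬cv)

  colour<3⇒uncut : colour v < 3 → cut v ≡ false
  colour<3⇒uncut {v} lt = ¬-not λ cv → <-irrefl (colour-root cv) lt

  colour-parent-≢ : colour v < 3 → colour (p v) ≢ colour v
  colour-parent-≢ {v} lt eq =
    skip-≢ {colour (p v)} {index v} (subst (_< 3) (sym eq) lt)
      (trans (sym (colour-child (colour<3⇒uncut lt))) (sym eq))

  index-injective : cut u ≡ false → cut v ≡ false → p u ≡ p v → index u ≡ index v → u ≡ v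
  index-injective {u} {v} ¬cu ¬cv pu≡pv eq with <-cmp u v
  ... | tri≈ _ u≡v _ = u≡v
  ... | tri< u<v _ _ = contradiction (trans eq (cong (λ w → count v (keptChild w)) (sym pu≡pv)))
    (<⇒≢ (count-strict u<v (∧-intro (≡ᵇ-complete {p u} refl) (cong not ¬cu))))
  ... | tri> _ _ v<u = contradiction (trans (sym eq) (cong (λ w → count u (keptChild w)) pu≡pv))
    (<⇒≢ (count-strict v<u (∧-intro (≡ᵇ-complete {p v} refl) (cong not ¬cv))))

  sibling-colour-injective : colour u < 3 → p u ≡ p v → colour u ≡ colour v → u ≡ v
  sibling-colour-injective {u} {v} lt pu≡pv eq = index-injective ¬cu ¬cv pu≡pv
    (skip-injective {colour (p u)} (subst (_< 3) (colour-child ¬cu) lt) (begin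
      skip (colour (p u)) (index u)  ≡⟨ colour-child ¬cu ⟨
      colour u                       ≡⟨ eq ⟩
      colour v                       ≡⟨ colour-child ¬cv ⟩
      skip (colour (p v)) (index v)  ≡⟨ cong (λ w → skip (colour w) (index v)) pu≡pv ⟨
      skip (colour (p u)) (index v)  ∎))
    where
    open ≡-Reasoning
    ¬cu : cut u ≡ false
    ¬cu = colour<3⇒uncut lt
    ¬cv : cut v ≡ false
    ¬cv = colour<3⇒uncut (subst (_< 3) eq lt)

  child-coloured : c < 3 → colour v ≢ c →
                   ∃[ u ] u < bound v × (p u ≡ᵇ v) ∧ (colour u ≡ᵇ c) ≡ true
  child-coloured {c} {v} c<3 ≢c =
    let i , i<3 , eq = skip-surjective (colour v) c<3 (≢c ∘ sym)
        u , u<B , kept , #u = pick {i} {bound v} {keptChild v} (<-≤-trans i<3 (keptChild-count v))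
        pu≡v = ≡ᵇ-sound (∧-elimˡ kept)
    in u , u<B , ∧-intro (≡ᵇ-complete pu≡v)
         (≡ᵇ-complete (coloured {u} {i} pu≡v (not-elim (∧-elimʳ {p u ≡ᵇ v} kept)) #u eq))
    where
    coloured : p u ≡ v → cut u ≡ false → count u (keptChild v) ≡ i → skip (colour v) i ≡ c → colour u ≡ c
    coloured {u} pu≡v ¬cu #u eq = trans (colour-child ¬cu)
      (trans (cong (λ w → skip (colour w) (count u (keptChild w))) pu≡v)
        (trans (cong (skip (colour v)) #u) eq))

  -- For `c < 3`, every vertex lies on exactly one edge of colour `c`, which leads to its parent or
  -- to one of its children.
  partner : ℕ → ℕ → ℕ
  partner c v = if colour v ≡ᵇ c then p v else least (bound v) λ u → (p u ≡ᵇ v) ∧ (colour u ≡ᵇ c)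

  partner-up : ∀ v → colour v ≡ c → partner c v ≡ p v
  partner-up {c} v eq =
    cong (λ b → if b then p v else least (bound v) λ u → (p u ≡ᵇ v) ∧ (colour u ≡ᵇ c))
      (≡ᵇ-complete {colour v} eq)

  partner-down : ∀ v → c < 3 → colour v ≢ c → p (partner c v) ≡ v × colour (partner c v) ≡ c
  partner-down {c} v c<3 ≢c = subst (λ u → p u ≡ v × colour u ≡ c) (sym partner≡)
    (≡ᵇ-sound (∧-elimˡ found) , ≡ᵇ-sound (∧-elimʳ {p (least (bound v) child) ≡ᵇ v} found))
    where
    child : ℕ → Bool
    child u = (p u ≡ᵇ v) ∧ (colour u ≡ᵇ c)

    partner≡ : partner c v ≡ least (bound v) child
    partner≡ = cong (λ b → if b then p v else least (bound v) child)
      (¬-not (≢c ∘ ≡ᵇ-sound {colour v} {c}))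

    found : child (least (bound v) child) ≡ true
    found = let u , u<B , eq = child-coloured c<3 ≢c in least-found {u} {bound v} {child} u<B eq

  -- A step down is undone by the step up. A step up followed by a step down ends at a sibling of
  -- the same colour, and such siblings coincide.
  partner-involutive : c < 3 → ∀ v → partner c (partner c v) ≡ v
  partner-involutive {c} c<3 v with colour v ≟ c
  ... | no ≢c  = let pu≡v , col = partner-down v c<3 ≢c in trans (partner-up (partner c v) col) pu≡v
  ... | yes v≡c = trans (cong (partner c) (partner-up v v≡c))
    (sibling-colour-injective (subst (_< 3) (sym col) c<3) pu≡ (trans col (sym v≡c)))
    where
    ≢c : colour (p v) ≢ c
    ≢c eq = colour-parent-≢ (subst (_< 3) (sym v≡c) c<3) (trans eq (sym v≡c))
    pu≡ : p (partner c (p v)) ≡ p v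
    pu≡ = proj₁ (partner-down (p v) c<3 ≢c)
    col : colour (partner c (p v)) ≡ c
    col = proj₂ (partner-down (p v) c<3 ≢c)

  module _ (p-rec : Recursive {1} λ xs → p (lookup xs 0F))
           (bound-rec : Recursive {1} λ xs → bound (lookup xs 0F)) where

    private
      variable
        N : ℕ
        f g : Vec ℕ N → ℕ

      rise-rec : Recursive f → Recursive g → Recursive (λ xs → rise (f xs) (g xs))
      rise-rec rf rg = app₂ {f = λ xs → rise (lookup xs 0F) (lookup xs 1F)}
        (least-rec (suc-rec (var 0F))
          (not-rec (mem-rec (iter-rec p p-rec (suc-rec (var 0F)) (var 1F)) (var 2F))))
        rf rg

      cutAt-rec : Recursive f → Recursive (λ xs → cutAt (f xs))
      cutAt-rec rf = iter-rec p p-rec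
        (rise-rec rf (history-rec (iter-rec p p-rec (suc-rec (rise-rec (var 0F) (var 1F))) (var 0F)) rf)) rf

      cut-rec : Recursive f → RecursiveP (λ xs → cut (f xs))
      cut-rec rf = recursiveP (app₁ {f = λ xs → bit (cut (lookup xs 0F))}
        (rec (any-rec (suc-rec (var 0F)) (≡ᵇ-rec (cutAt-rec (var 0F)) (var 1F)))) rf)

      depth-rec : Recursive f → Recursive (λ xs → depth (f xs))
      depth-rec rf = app₁ {f = λ xs → depth (lookup xs 0F)}
        (search-rec (cut-rec (iter-rec p p-rec (var 0F) (var 1F))) (λ xs → depth (lookup xs 0F))
          (λ xs → depth-cut (lookup xs 0F)) (λ xs → depth-least (lookup xs 0F)))
        rf

      index-rec : Recursive f → Recursive (λ xs → index (f xs))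
      index-rec rf = app₁ {f = λ xs → index (lookup xs 0F)}
        (count-rec (var 0F)
          (∧-rec (≡ᵇ-rec (app₁ p-rec (var 0F)) (app₁ p-rec (var 1F))) (not-rec (cut-rec (var 0F)))))
        rf

      skip-rec : Recursive f → Recursive g → Recursive (λ xs → skip (f xs) (g xs))
      skip-rec {f = f} {g = g} rf rg = Recursive-cong
        (λ xs → sym (⊓-via-∸ 3 (if g xs <ᵇ f xs then g xs else suc (g xs))))
        (∸-rec (const-rec 3) (∸-rec (const-rec 3) (if-rec (<ᵇ-rec rg rf) rg (suc-rec rg))))
        where
        ⊓-via-∸ : ∀ m n → m ⊓ n ≡ m ∸ (m ∸ n)
        ⊓-via-∸ m n with ≤-total m n
        ... | inj₁ m≤n = trans (m≤n⇒m⊓n≡m m≤n) (cong (m ∸_) (sym (m≤n⇒m∸n≡0 m≤n)))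
        ... | inj₂ n≤m = trans (m≥n⇒m⊓n≡n n≤m) (sym (m∸[m∸n]≡n n≤m))

      -- The colours along the path down from the d-th ancestor of v, as a recursion
      -- that leaves v and d fixed.
      descend : ℕ → ℕ → ℕ → ℕ
      descend d v zero    = 3
      descend d v (suc j) = skip (descend d v j) (index (iter p (d ∸ suc j) v))

      descend-colour : ∀ d v {j} → j ≤ d → descend d v j ≡ colourFrom j (iter p (d ∸ j) v)
      descend-colour d v {zero}  _   = refl
      descend-colour d v {suc j} j<d = cong (λ c → skip c (index (iter p (d ∸ suc j) v)))
        (trans (descend-colour d v (<⇒≤ j<d))
          (cong (λ k → colourFrom j (iter p k v)) (+-∸-assoc 1 j<d)))

      colour-rec : Recursive f → Recursive (λ xs → colour (f xs))
      colour-rec rf = app₁ {f = λ xs → colour (lookup xs 0F)}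
        (Recursive-cong
          (λ xs → trans (descend-colour (depth (lookup xs 0F)) (lookup xs 0F) ≤-refl)
            (cong (λ k → colourFrom (depth (lookup xs 0F)) (iter p k (lookup xs 0F))) (n∸n≡0 (depth (lookup xs 0F)))))
          (app₃ {f = λ xs → descend (lookup xs 0F) (lookup xs 1F) (lookup xs 2F)}
            (primrec (λ k xs → descend (lookup xs 0F) (lookup xs 1F) k) (const-rec 3)
              (skip-rec (var 1F) (index-rec (iter-rec p p-rec (∸-rec (var 2F) (suc-rec (var 0F))) (var 3F))))
              (λ _ _ → refl) (var 2F))
            (depth-rec (var 0F)) (var 0F) (depth-rec (var 0F))))
        rf

    partner-rec : ∀ c → Recursive f → Recursive (λ xs → partner c (f xs))
    partner-rec c rf = app₁ {f = λ xs → partner c (lookup xs 0F)}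
      (if-rec (≡ᵇ-rec (colour-rec (var 0F)) (const-rec c)) (app₁ p-rec (var 0F))
        (least-rec (app₁ bound-rec (var 0F))
          (∧-rec (≡ᵇ-rec (app₁ p-rec (var 0F)) (var 1F)) (≡ᵇ-rec (colour-rec (var 0F)) (const-rec c)))))
      rf

-- Freeness by way of reduced words

module FreeSubgroup {c ℓ p} (G : Group c ℓ) {n : ℕ} (generator : Fin n → Group.Carrier G)
  (S : Pred (Group.Carrier G) p) (generator∈S : ∀ x → S (generator x))
  (S⊆generators : ∀ {y} → S y → ∃[ x ] Group._≈_ G (generator x) y) where

  private module G = Group G
  open Group G hiding (refl; sym; trans; reflexive)
  open GroupProperties G using (inverseˡ-unique)
  private module Free = Group (FreeGroup (Fin n))

  Letter : Set
  Letter = Fin n × Sign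

  inverseLetter : Letter → Letter
  inverseLetter (x , s) = x , opposite s

  letter : Letter → Carrier
  letter (x , Sign.+) = generator x
  letter (x , Sign.-) = generator x ⁻¹

  eval : Word (Fin n) → Carrier
  eval []      = ε
  eval (l ∷ w) = letter l ∙ eval w

  eval-++ : ∀ u v → eval (u ++ v) ≈ eval u ∙ eval v
  eval-++ []      v = G.sym (identityˡ (eval v))
  eval-++ (l ∷ u) v = G.trans (∙-congˡ (eval-++ u v)) (G.sym (assoc (letter l) (eval u) (eval v)))

  letter-inverse : ∀ l → letter l ∙ letter (inverseLetter l) ≈ ε
  letter-inverse (x , Sign.+) = inverseʳ (generator x)
  letter-inverse (x , Sign.-) = inverseˡ (generator x)

  eval-⟶ : ∀ {u v} → _⟶_ (Fin n) u v → eval u ≈ eval v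
  eval-⟶ (cancel u x s v) = begin
    eval (u ++ l ∷ l⁻¹ ∷ v)                      ≈⟨ eval-++ u (l ∷ l⁻¹ ∷ v) ⟩
    eval u ∙ (letter l ∙ (letter l⁻¹ ∙ eval v))  ≈⟨ ∙-congˡ (assoc (letter l) (letter l⁻¹) (eval v)) ⟨
    eval u ∙ ((letter l ∙ letter l⁻¹) ∙ eval v)  ≈⟨ ∙-congˡ (∙-congʳ (letter-inverse l)) ⟩
    eval u ∙ (ε ∙ eval v)                        ≈⟨ ∙-congˡ (identityˡ (eval v)) ⟩
    eval u ∙ eval v                              ≈⟨ eval-++ u v ⟨
    eval (u ++ v)                                ∎
    where
    open SetoidReasoning setoid
    l l⁻¹ : Letter
    l   = x , s
    l⁻¹ = x , opposite s

  eval-cong : ∀ {u v} → u Free.≈ v → eval u ≈ eval v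
  eval-cong = EqC.gfold isEquivalence eval eval-⟶

  eval-invert : ∀ w → eval (w Free.⁻¹) ≈ eval w ⁻¹
  eval-invert w = inverseˡ-unique _ _
    (G.trans (G.sym (eval-++ (w Free.⁻¹) w)) (eval-cong (Free.inverseˡ w)))

  eval-generated : ∀ w → Generated G S (eval w)
  eval-generated []            = unit
  eval-generated ((x , Sign.+) ∷ w) = mul (gen (generator∈S x)) (eval-generated w)
  eval-generated ((x , Sign.-) ∷ w) = mul (inv (gen (generator∈S x))) (eval-generated w)

  word : ∀ {y} → Generated G S y → ∃[ w ] eval w ≈ y
  word (gen y∈S) = let x , eq = S⊆generators y∈S in
    (x , Sign.+) ∷ [] , G.trans (identityʳ (generator x)) eq
  word (resp eq y∈) = let w , eq′ = word y∈ in w , G.trans eq′ eq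
  word unit = [] , G.refl
  word (mul y∈ z∈) = let u , eq₁ = word y∈ ; v , eq₂ = word z∈ in
    u ++ v , G.trans (eval-++ u v) (∙-cong eq₁ eq₂)
  word (inv y∈) = let w , eq = word y∈ in w Free.⁻¹ , G.trans (eval-invert w) (⁻¹-cong eq)

  Reduced : Word (Fin n) → Set
  Reduced = Linked λ l m → m ≢ inverseLetter l

  _≟ₗ_ : (l m : Letter) → Dec (l ≡ m)
  _≟ₗ_ = ≡-dec Fin._≟_ Sign._≟_

  cons : Letter → Word (Fin n) → Word (Fin n)
  cons l []      = l ∷ []
  cons l (m ∷ w) with m ≟ₗ inverseLetter l
  ... | yes _ = w
  ... | no  _ = l ∷ m ∷ w

  cons-reduced : ∀ l {w} → Reduced w → Reduced (cons l w)
  cons-reduced l {[]}    _ = [-]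
  cons-reduced l {m ∷ w} r with m ≟ₗ inverseLetter l
  ... | yes _   = Linked.tail r
  ... | no  m≢l = m≢l ∷ r

  cons-≈ : ∀ l w → cons l w Free.≈ l ∷ w
  cons-≈ l []      = Free.refl
  cons-≈ l@(x , s) (m ∷ w) with m ≟ₗ inverseLetter l
  ... | yes refl = Free.sym (EqC.return (cancel [] x s w))
  ... | no  _    = Free.refl

  reduce : Word (Fin n) → Word (Fin n)
  reduce []      = []
  reduce (l ∷ w) = cons l (reduce w)

  reduce-reduced : ∀ w → Reduced (reduce w)
  reduce-reduced []      = []
  reduce-reduced (l ∷ w) = cons-reduced l (reduce-reduced w)

  reduce-≈ : ∀ w → reduce w Free.≈ w
  reduce-≈ []      = Free.refl
  reduce-≈ (l ∷ w) = Free.trans (cons-≈ l (reduce w)) (Free.∙-congˡ {l ∷ []} (reduce-≈ w))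

  reducedWord : ∀ {y} → Generated G S y → ∃[ w ] Reduced w × eval w ≈ y
  reducedWord y∈ = let w , eq = word y∈ in
    reduce w , reduce-reduced w , G.trans (eval-cong (reduce-≈ w)) eq

  module _ (nontrivial : ∀ w → Reduced w → w ≢ [] → ¬ (eval w ≈ ε)) where

    -- The quotient of the two words evaluates to the identity, so its reduced form cannot be
    -- non-empty.
    eval-injective : ∀ {u v} → eval u ≈ eval v → u Free.≈ v
    eval-injective {u} {v} eq = x∙y⁻¹≈ε⇒x≈y u v (trivial (reduce d) refl)
      where
      open GroupProperties (FreeGroup (Fin n)) using (x∙y⁻¹≈ε⇒x≈y)
      d : Word (Fin n)
      d = u Free.∙ v Free.⁻¹

      eval-d : eval d ≈ ε
      eval-d = begin
        eval d                     ≈⟨ eval-++ u (v Free.⁻¹) ⟩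
        eval u ∙ eval (v Free.⁻¹)  ≈⟨ ∙-cong eq (eval-invert v) ⟩
        eval v ∙ eval v ⁻¹         ≈⟨ inverseʳ (eval v) ⟩
        ε                          ∎
        where open SetoidReasoning setoid

      trivial : ∀ w → reduce d ≡ w → d Free.≈ []
      trivial []      eq = Free.trans (Free.sym (reduce-≈ d)) (Free.reflexive eq)
      trivial (l ∷ w) eq = contradiction (G.trans (eval-cong (reduce-≈ d)) eval-d)
        (nontrivial (reduce d) (reduce-reduced d) λ eq′ → nonempty (trans (sym eq) eq′))
        where
        nonempty : l ∷ w ≢ []
        nonempty ()

    freeOfRank : FreeOfRank n (subgroup G (generated-isSubgroup G S))
    freeOfRank = (λ w → eval w , eval-generated w) , record
      { isGroupMonomorphism = record
        { isGroupHomomorphism = record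
          { isMonoidHomomorphism = record
            { isMagmaHomomorphism = record
              { isRelHomomorphism = record { cong = eval-cong }
              ; homo              = eval-++
              }
            ; ε-homo = G.refl
            }
          ; ⁻¹-homo = eval-invert
          }
        ; injective = eval-injective
        }
      ; surjective = λ (y , y∈) → let w , eq = word y∈ in
          w , λ z≈w → G.trans (eval-cong z≈w) eq
      }

-- Three involutions acting on the forest, and the free group inside

Colour : Set
Colour = Fin 3

Alternating : List Colour → Set
Alternating = Linked _≢_

push : Colour → List Colour → List Colour
push c []       = c ∷ []
push c (d ∷ cs) with c Fin.≟ d
... | yes _ = cs
... | no  _ = c ∷ d ∷ cs

push-alternating : ∀ c {cs} → Alternating cs → Alternating (push c cs)
push-alternating c {[]}     _   = [-]
push-alternating c {d ∷ cs} alt with c Fin.≟ d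
... | yes _  = Linked.tail alt
... | no c≢d = c≢d ∷ alt

module Walks (p bound : ℕ → ℕ) (wide : ∀ w → 5 ≤ count (bound w) λ u → p u ≡ᵇ w) where

  open Forest p bound wide

  private
    variable
      c d : Colour
      cs  : List Colour
      u v : ℕ

  step : Colour → ℕ → ℕ
  step c = partner (toℕ c)

  step-involutive : ∀ c v → step c (step c v) ≡ v
  step-involutive c = partner-involutive (Fin.toℕ<n c)

  act : List Colour → ℕ → ℕ
  act []       v = v
  act (c ∷ cs) v = step c (act cs v)

  act-push : ∀ c cs v → act (push c cs) v ≡ step c (act cs v)
  act-push c []       v = refl
  act-push c (d ∷ cs) v with c Fin.≟ d
  ... | yes refl = sym (step-involutive c (act cs v))
  ... | no  _    = refl

  -- A walk along an alternating word goes up for a while and then down: having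
  -- just gone down to u, it could only go up along the edge by which it came.
  data Walk (v : ℕ) : List Colour → ℕ → Set where
    up   : iter p (length cs) v ≡ u → depth v ≡ length cs + depth u →
           (∀ {c ds} → cs ≡ c ∷ ds → colour (iter p (length ds) v) ≡ toℕ c) →
           Walk v cs u
    down : ∀ m j → iter p (suc j) u ≡ iter p m v →
           depth v ≡ m + depth (iter p m v) → depth u ≡ suc j + depth (iter p m v) →
           colour u ≡ toℕ c → (∀ {l} → m ≡ suc l → iter p j u ≢ iter p l v) →
           Walk v (c ∷ cs) u

  depth-coloured : colour u ≡ toℕ c → depth u ≡ suc (depth (p u))
  depth-coloured {c = c} eq = depth-suc (colour<3⇒uncut (subst (_< 3) (sym eq) (Fin.toℕ<n c)))

  module _ (c : Colour) {v u : ℕ} where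

    step-up : colour u ≡ toℕ c → iter p (length cs) v ≡ u → depth v ≡ length cs + depth u →
              Walk v (c ∷ cs) (step c u)
    step-up {cs} col path≡ depth≡ = subst (Walk v (c ∷ cs)) (sym (partner-up u col)) (up
      (cong p path≡)
      (trans depth≡ (trans (cong (length cs +_) (depth-coloured {u} {c} col)) (+-suc (length cs) (depth (p u)))))
      λ { refl → trans (cong colour path≡) col })

    -- The vertex from which the walk climbed to `u` hangs on an edge of colour `d`, different from
    -- `c`, so the descent enters another child. For empty `cs` there is no such vertex.
    step-down : colour u ≢ toℕ c → iter p (length cs) v ≡ u → depth v ≡ length cs + depth u →
                (∀ {d ds} → cs ≡ d ∷ ds → c ≢ d × colour (iter p (length ds) v) ≡ toℕ d) →
                Walk v (c ∷ cs) (step c u)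
    step-down {cs} ≢c path≡ depth≡ last =
      let pu′≡u , col = partner-down u (Fin.toℕ<n c) ≢c in
      down (length cs) 0 (trans pu′≡u (sym path≡))
        (trans depth≡ (cong (λ w → length cs + depth w) (sym path≡)))
        (trans (depth-coloured {step c u} {c} col) (cong (suc ∘ depth) (trans pu′≡u (sym path≡))))
        col (distinct cs last col)
      where
      distinct : ∀ cs → (∀ {d ds} → cs ≡ d ∷ ds → c ≢ d × colour (iter p (length ds) v) ≡ toℕ d) →
                 ∀ {u′} → colour u′ ≡ toℕ c → ∀ {l} → length cs ≡ suc l → u′ ≢ iter p l v
      distinct (d ∷ ds) last col refl u′≡ = let c≢d , col′ = last refl in
        c≢d (Fin.toℕ-injective (trans (sym col) (trans (cong colour u′≡) col′)))

    extend : (∀ {d ds} → cs ≡ d ∷ ds → c ≢ d) → Walk v cs u → Walk v (c ∷ cs) (step c u)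
    extend {cs} head≢ (up path≡ depth≡ last) = by-colour (colour u ≟ toℕ c)
      where
      by-colour : Dec (colour u ≡ toℕ c) → Walk v (c ∷ cs) (step c u)
      by-colour (yes col) = step-up col path≡ depth≡
      by-colour (no  ≢c)  = step-down ≢c path≡ depth≡ λ eq → head≢ eq , last eq
    extend {d ∷ cs} head≢ (down m j path≡ depth-v depth-u col last) =
      let pu′≡u , col′ = partner-down u (Fin.toℕ<n c) ≢c in
      down m (suc j)
        (trans (sym (iter-shift p (suc j) (step c u))) (trans (cong (iter p (suc j)) pu′≡u) path≡))
        depth-v
        (trans (depth-coloured {step c u} {c} col′) (cong suc (trans (cong depth pu′≡u) depth-u)))
        col′
        λ m≡ eq → last m≡ (trans (sym (trans (sym (iter-shift p j (step c u))) (cong (iter p j) pu′≡u))) eq)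
      where
      ≢c : colour u ≢ toℕ c
      ≢c eq = head≢ refl (Fin.toℕ-injective (trans (sym eq) col))

  walk : Alternating cs → ∀ v → Walk v cs (act cs v)
  walk []            v = up refl refl λ ()
  walk {c ∷ _} [-]   v = extend c (λ ()) (walk [] v)
  walk {c ∷ _} (c≢d ∷ alt) v = extend c (λ { refl → c≢d }) (walk alt v)

  -- A non-empty climb lowers the depth. A walk with a descent that returned to `v` would have legs
  -- of equal length, by the two depth equations, and so pass through the same child of its highest
  -- point twice.
  act-fixed-point-free : Alternating cs → cs ≢ [] → ∀ v → act cs v ≢ v
  act-fixed-point-free {cs} alt nonempty v eq = no-loop (subst (Walk v cs) eq (walk alt v)) nonempty
    where
    no-loop : ∀ {cs} → Walk v cs v → cs ≢ [] → ⊥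
    no-loop {[]}    _                nonempty = nonempty refl
    no-loop {_ ∷ _} (up _ depth≡ _) _        = m≢1+n+m (depth v) depth≡
    no-loop (down m j _ depth≡ depth≡′ _ last) _ =
      last (+-cancelʳ-≡ _ m (suc j) (trans (sym depth≡) depth≡′)) refl

  perm : Colour → ℕ ↔ ℕ
  perm c = mk↔ₛ′ (step c) (step c) (step-involutive c) (step-involutive c)

  -- In the free product of three groups of order two, the elements of even length form a subgroup
  -- of index two with basis ab, bc.
  σ π : ℕ ↔ ℕ
  σ = perm 0F ↔-∘ perm 1F
  π = perm 1F ↔-∘ perm 2F

  Generators : Pred (ℕ ↔ ℕ) 0ℓ
  Generators = ｛ σ ｝ ∪ ｛ π ｝

  generator : Fin 2 → ℕ ↔ ℕ
  generator 0F = σ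
  generator 1F = π

  generator-∈ : ∀ x → Generators (generator x)
  generator-∈ 0F = inj₁ refl
  generator-∈ 1F = inj₂ refl

  Generators-⊆ : ∀ {α} → Generators α → ∃[ x ] Group._≈_ (Sym ℕ) (generator x) α
  Generators-⊆ (inj₁ refl) = 0F , λ _ → refl
  Generators-⊆ (inj₂ refl) = 1F , λ _ → refl

  open FreeSubgroup (Sym ℕ) generator Generators generator-∈ Generators-⊆ public

  first second : Letter → Colour
  first (0F , Sign.+) = 0F
  first (0F , Sign.-) = 1F
  first (1F , Sign.+) = 1F
  first (1F , Sign.-) = 2F
  second (0F , Sign.+) = 1F
  second (0F , Sign.-) = 0F
  second (1F , Sign.+) = 2F
  second (1F , Sign.-) = 1F

  expand : Word (Fin 2) → List Colour
  expand []      = []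
  expand (l ∷ w) = push (first l) (push (second l) (expand w))

  expand-alternating : ∀ w → Alternating (expand w)
  expand-alternating []      = []
  expand-alternating (l ∷ w) = push-alternating (first l) (push-alternating (second l) (expand-alternating w))

  to-letter : ∀ l v → Inverse.to (letter l) v ≡ step (first l) (step (second l) v)
  to-letter (0F , Sign.+) v = refl
  to-letter (0F , Sign.-) v = refl
  to-letter (1F , Sign.+) v = refl
  to-letter (1F , Sign.-) v = refl

  act-expand : ∀ w v → act (expand w) v ≡ Inverse.to (eval w) v
  act-expand []      v = refl
  act-expand (l ∷ w) v = begin
    act (expand (l ∷ w)) v                                 ≡⟨ act-push (first l) (push (second l) (expand w)) v ⟩
    step (first l) (act (push (second l) (expand w)) v)    ≡⟨ cong (step (first l)) (act-push (second l) (expand w) v) ⟩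
    step (first l) (step (second l) (act (expand w) v))    ≡⟨ cong (λ u → step (first l) (step (second l) u)) (act-expand w v) ⟩
    step (first l) (step (second l) (Inverse.to (eval w) v)) ≡⟨ to-letter l (Inverse.to (eval w) v) ⟨
    Inverse.to (letter l) (Inverse.to (eval w) v)          ∎
    where open ≡-Reasoning

  -- The initial segment of the expansion of a reduced word that is determined by
  -- its first letter.  Only the pairs (0 1)(1 2) and (2 1)(1 0) cancel, by one colour.
  Prefix : Letter → List Colour → Set
  Prefix (0F , Sign.+) cs = ∃[ ds ] cs ≡ 0F ∷ ds
  Prefix (0F , Sign.-) cs = ∃[ ds ] cs ≡ 1F ∷ 0F ∷ ds
  Prefix (1F , Sign.+) cs = ∃[ ds ] cs ≡ 1F ∷ 2F ∷ ds
  Prefix (1F , Sign.-) cs = ∃[ ds ] cs ≡ 2F ∷ ds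

  -- After one of the two cancellations the colours 0 and 2 become adjacent, and as they differ the
  -- cancellation stops. To see this, the prefixes that begin with 1 must record their second
  -- colour.
  expand-prefix : ∀ l w → Reduced (l ∷ w) → Prefix l (expand (l ∷ w))
  expand-prefix (0F , Sign.+) [] _ = _ , refl
  expand-prefix (0F , Sign.-) [] _ = _ , refl
  expand-prefix (1F , Sign.+) [] _ = _ , refl
  expand-prefix (1F , Sign.-) [] _ = _ , refl
  expand-prefix l (m ∷ w) (m≢l⁻¹ ∷ r) = go l m (expand (m ∷ w)) m≢l⁻¹ (expand-prefix m w r)
    where
    go : ∀ l m cs → m ≢ inverseLetter l → Prefix m cs → Prefix l (push (first l) (push (second l) cs))
    go (0F , Sign.+) (0F , Sign.+) _ _  (ds , refl) = _ , refl
    go (0F , Sign.+) (1F , Sign.+) _ _  (ds , refl) = _ , refl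
    go (0F , Sign.+) (1F , Sign.-) _ _  (ds , refl) = _ , refl
    go (0F , Sign.-) (0F , Sign.-) _ _  (ds , refl) = _ , refl
    go (0F , Sign.-) (1F , Sign.+) _ _  (ds , refl) = _ , refl
    go (0F , Sign.-) (1F , Sign.-) _ _  (ds , refl) = _ , refl
    go (1F , Sign.+) (0F , Sign.+) _ _  (ds , refl) = _ , refl
    go (1F , Sign.+) (0F , Sign.-) _ _  (ds , refl) = _ , refl
    go (1F , Sign.+) (1F , Sign.+) _ _  (ds , refl) = _ , refl
    go (1F , Sign.-) (0F , Sign.+) _ _  (ds , refl) = _ , refl
    go (1F , Sign.-) (0F , Sign.-) _ _  (ds , refl) = _ , refl
    go (1F , Sign.-) (1F , Sign.-) _ _  (ds , refl) = _ , refl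
    go (0F , Sign.+) (0F , Sign.-) _ ≢l _           = contradiction refl ≢l
    go (0F , Sign.-) (0F , Sign.+) _ ≢l _           = contradiction refl ≢l
    go (1F , Sign.+) (1F , Sign.-) _ ≢l _           = contradiction refl ≢l
    go (1F , Sign.-) (1F , Sign.+) _ ≢l _           = contradiction refl ≢l

  prefix-nonempty : ∀ l {cs} → Prefix l cs → cs ≢ []
  prefix-nonempty (0F , Sign.+) (_ , refl) ()
  prefix-nonempty (0F , Sign.-) (_ , refl) ()
  prefix-nonempty (1F , Sign.+) (_ , refl) ()
  prefix-nonempty (1F , Sign.-) (_ , refl) ()

  eval-fixed-point-free : ∀ w → Reduced w → w ≢ [] → ∀ v → Inverse.to (eval w) v ≢ v
  eval-fixed-point-free []      _ nonempty = contradiction refl nonempty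
  eval-fixed-point-free (l ∷ w) r _ v eq   = act-fixed-point-free
    (expand-alternating (l ∷ w)) (prefix-nonempty l (expand-prefix l w r)) v
    (trans (act-expand (l ∷ w) v) eq)

  free : FreeOfRank 2 (subgroup (Sym ℕ) (generated-isSubgroup (Sym ℕ) Generators))
  -- Reduced words move every point, so the point 0 refutes equality with the identity.
  free = freeOfRank λ w r nonempty eq → eval-fixed-point-free w r nonempty 0 (eq 0)

  semiRegular : SemiRegular (Generated (Sym ℕ) Generators)
  semiRegular {α} α∈ α≉ε x αx≡x with reducedWord α∈
  ... | []    , _ , eq = α≉ε λ y → sym (eq y)
  ... | l ∷ w , r , eq = eval-fixed-point-free (l ∷ w) r (λ ()) x (trans (eq x) αx≡x)

-- From the expanding entourage to the two permutations

∈-bound : (xs : List ℕ) → ∃[ b ] (∀ {x} → x List.∈ xs → x < b)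
∈-bound []       = 0 , λ ()
∈-bound (x ∷ xs) = let b , xs<b = ∈-bound xs in suc x ⊔ b , λ where
  (here refl)  → m≤m⊔n (suc x) b
  (there y∈xs) → ≤-trans (xs<b y∈xs) (m≤n⊔m (suc x) b)

-- Division by five, written as a primitive recursion so that its code can be read off.
quotient : ℕ → ℕ
quotient zero    = 0
quotient (suc t) = if 5 * suc (quotient t) ≤ᵇ suc t then suc (quotient t) else quotient t

quotient-spec : ∀ t → 5 * quotient t ≤ t × t < 5 * suc (quotient t)
quotient-spec zero    = z≤n , s≤s z≤n
quotient-spec (suc t) with 5 * suc (quotient t) ≤ᵇ suc t in eq
... | true  = ≤ᵇ-sound eq , (begin-strict
  suc t                            <⟨ s≤s (proj₂ (quotient-spec t)) ⟩
  1 + 5 * suc (quotient t)         ≤⟨ +-monoˡ-≤ (5 * suc (quotient t)) {1} {5} (s≤s z≤n) ⟩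
  5 + 5 * suc (quotient t)         ≡⟨ *-suc 5 (suc (quotient t)) ⟨
  5 * suc (suc (quotient t))       ∎)
  where open ≤-Reasoning
... | false = m≤n⇒m≤1+n (proj₁ (quotient-spec t)) , ≰⇒> λ le → true≢false (≤ᵇ-complete le) eq

quotient-unique : ∀ {w t} → 5 * w ≤ t → t < 5 * suc w → quotient t ≡ w
quotient-unique {w} {t} w≤ t< = ≤-antisym
  (≤-pred (*-cancelˡ-< 5 _ _ (≤-<-trans (proj₁ (quotient-spec t)) t<)))
  (≤-pred (*-cancelˡ-< 5 _ _ (≤-<-trans w≤ (proj₂ (quotient-spec t)))))

quotient-+ : ∀ w {i} → i < 5 → quotient (i + 5 * w) ≡ w
quotient-+ w {i} i<5 = quotient-unique (m≤n+m (5 * w) i)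
  (<-≤-trans (+-monoˡ-< (5 * w) i<5) (≤-reflexive (sym (*-suc 5 w))))

quotient-≤ : ∀ t → quotient t ≤ t
quotient-≤ t = ≤-trans (m≤n*m (quotient t) 5) (proj₁ (quotient-spec t))

quotient-rec : ∀ {N} {f : Vec ℕ N → ℕ} → Recursive f → Recursive (λ xs → quotient (f xs))
quotient-rec rf = app₁ {f = λ xs → quotient (lookup xs 0F)}
  (primrec (λ k _ → quotient k) (const-rec 0)
    (if-rec (≤ᵇ-rec (*-rec (const-rec 5) (suc-rec (var 1F))) (suc-rec (var 0F))) (suc-rec (var 1F)) (var 1F))
    (λ _ _ → refl) (var 0F))
  rf

someSlot : (ℕ → Bool) → ℕ → Bool
someSlot F x = any 5 λ i → F (i + 5 * x)

count-slots : ∀ F m → count (5 * m) F ≤ 5 * count m (someSlot F)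
count-slots F zero    = z≤n
count-slots F (suc m) = begin
  count (5 * suc m) F
    ≡⟨ cong (λ k → count k F) (*-suc 5 m) ⟩
  b 4 + (b 3 + (b 2 + (b 1 + (b 0 + count (5 * m) F))))
    ≤⟨ +-mono-≤ (slot 4F) (+-mono-≤ (slot 3F) (+-mono-≤ (slot 2F) (+-mono-≤ (slot 1F)
         (+-mono-≤ (slot 0F) (count-slots F m))))) ⟩
  s + (s + (s + (s + (s + 5 * count m (someSlot F)))))
    ≡⟨ solve 2 (λ s n → s :+ (s :+ (s :+ (s :+ (s :+ con 5 :* n)))) := con 5 :* (s :+ n)) refl s (count m (someSlot F)) ⟩
  5 * (s + count m (someSlot F)) ∎
  where
  open ≤-Reasoning
  b : ℕ → ℕ
  b i = bit (F (i + 5 * m))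

  s : ℕ
  s = bit (someSlot F m)

  slot : (i : Fin 5) → b (toℕ i) ≤ s
  slot i = bit-mono (any-intro {P = λ j → F (j + 5 * m)} (Fin.toℕ<n i))

module Construction
  (E : Rel ℕ 0ℓ) (E-hc : HighlyComputable E)
  (expands : ∀ (F : Pred ℕ 0ℓ) (m k : ℕ) → HasSize F m → HasSize (E [ F ]) k → k ≥ 6 * m)
  where

  open HighlyComputable E-hc renaming (symmetric to E-sym)

  χ : ℕ → ℕ → ℕ
  χ = proj₁ computable

  adj : ℕ → ℕ → Bool
  adj x y = χ x y ≡ᵇ 1

  E⇒adj : ∀ {x y} → E x y → adj x y ≡ true
  E⇒adj {x} {y} Exy with proj₂ (proj₂ computable) x y
  ... | inj₁ (_ , χ≡1)  = ≡ᵇ-complete {χ x y} χ≡1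
  ... | inj₂ (¬Exy , _) = contradiction Exy ¬Exy

  adj⇒E : ∀ {x y} → adj x y ≡ true → E x y
  adj⇒E {x} {y} eq with proj₂ (proj₂ computable) x y
  ... | inj₁ (Exy , _) = Exy
  ... | inj₂ (_ , χ≡0) = contradiction (trans (sym χ≡0) (≡ᵇ-sound {χ x y} eq)) λ ()

  adj-sym : ∀ {x y} → adj x y ≡ true → adj y x ≡ true
  adj-sym = E⇒adj ∘ E-sym ∘ adj⇒E

  rowSize : ℕ → ℕ
  rowSize = proj₁ size

  abstract
    rowEnd : ∀ x → ∃[ b ] (∀ {y} → adj x y ≡ true → y < b) × count b (adj x) ≡ rowSize x
    rowEnd x =
      let xs , xs! , length≡ , E⊆ , ⊆E = proj₂ (proj₂ size) x
          b , <b = ∈-bound xs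
      in b , (λ eq → <b (E⊆ (adj⇒E eq))) ,
         hasSize-unique (hasSize-count (λ Exy → <b (E⊆ Exy) , E⇒adj Exy) adj⇒E)
           (xs , xs! , length≡ , E⊆ , ⊆E)

    -- The size function makes the rows computable: once `rowSize x` neighbours have been found
    -- below `b`, there are no others. `rowEnd` guarantees that this happens, but its bound comes
    -- from a listing that no `Code` produces.
    rowBound : ℕ → ℕ
    rowBound x = least (suc (proj₁ (rowEnd x))) λ b → count b (adj x) ≡ᵇ rowSize x

    rowBound-found : ∀ x → (count (rowBound x) (adj x) ≡ᵇ rowSize x) ≡ true
    rowBound-found x = least-found {proj₁ (rowEnd x)} {P = λ b → count b (adj x) ≡ᵇ rowSize x}
      (n<1+n _) (≡ᵇ-complete (proj₂ (proj₂ (rowEnd x))))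

    rowBound-least : ∀ x {j} → j < rowBound x → (count j (adj x) ≡ᵇ rowSize x) ≡ false
    rowBound-least x = least-minimal {P = λ b → count b (adj x) ≡ᵇ rowSize x} (suc (proj₁ (rowEnd x)))

    rowBound-bounds : ∀ {x y} → adj x y ≡ true → y < rowBound x
    rowBound-bounds {x} {y} xy = ≰⇒> λ b≤y → <-irrefl refl (begin-strict
      rowSize x                    ≡⟨ ≡ᵇ-sound (rowBound-found x) ⟨
      count (rowBound x) (adj x)   ≤⟨ count-extend b≤y ⟩
      count y (adj x)              <⟨ count-strict (n<1+n y) xy ⟩
      count (suc y) (adj x)        ≤⟨ count-bounded (suc y) (proj₁ (rowEnd x)) (proj₁ (proj₂ (rowEnd x))) ⟩
      count (proj₁ (rowEnd x)) (adj x) ≡⟨ proj₂ (proj₂ (rowEnd x)) ⟩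
      rowSize x                    ∎)
      where open ≤-Reasoning

  bound : ℕ → ℕ
  bound zero    = 0
  bound (suc m) = rowBound m ⊔ bound m

  bound-bounds : ∀ {x y m} → adj x y ≡ true → x < m → y < bound m
  bound-bounds {m = suc m} xy x<1+m with m<1+n⇒m<n∨m≡n x<1+m
  ... | inj₁ x<m  = ≤-trans (bound-bounds xy x<m) (m≤n⊔m (rowBound m) (bound m))
  ... | inj₂ refl = ≤-trans (rowBound-bounds xy) (m≤m⊔n (rowBound m) (bound m))

  -- The points t with quotient t ≡ w are five copies of w, so that a matching
  -- selects five neighbours of every vertex.
  slotAdj : ℕ → ℕ → Bool
  slotAdj t = adj (quotient t)

  slotBound : ℕ → ℕ
  slotBound n = 5 * bound n

  slotBound-bounds : ∀ {t z n} → slotAdj t z ≡ true → z < n → t < slotBound n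
  slotBound-bounds {t} tz z<n = <-≤-trans (proj₂ (quotient-spec t))
    (*-monoʳ-≤ 5 (bound-bounds (adj-sym tz) z<n))

  -- A set of copies is at most five times as large as its projection `F′` and has the same
  -- neighbours, whence 6|F| ≤ 30|F′| ≤ 5|E[F′]|.
  slot-expansion : ∀ M F → (∀ {x} → F x ≡ true → x < M) →
                   6 * count M F ≤ 5 * count (bound M) (neighbours slotAdj slotBound F)
  slot-expansion M F F<M = begin
    6 * count M F                        ≤⟨ *-monoʳ-≤ 6 (≤-trans (count-extend (m≤n*m M 5)) (count-slots F M)) ⟩
    6 * (5 * count M F′)                 ≡⟨ trans (sym (*-assoc 6 5 (count M F′))) (*-assoc 5 6 (count M F′)) ⟩
    5 * (6 * count M F′)                 ≤⟨ *-monoʳ-≤ 5 (expands (λ x → F′ x ≡ true) _ _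
                                              (hasSize-count (λ eq → F′<M eq , eq) (λ eq → eq))
                                              (hasSize-count N⁺ N⁻)) ⟩
    5 * count (bound M) N                ∎
    where
    open ≤-Reasoning
    F′ N : ℕ → Bool
    F′ = someSlot F
    N  = neighbours slotAdj slotBound F

    F′-elim : ∀ {x} → F′ x ≡ true → ∃[ t ] F t ≡ true × quotient t ≡ x
    F′-elim {x} eq = let i , i<5 , Fi = any-elim {5} {λ i → F (i + 5 * x)} eq in
      i + 5 * x , Fi , quotient-+ x i<5

    F′<M : ∀ {x} → F′ x ≡ true → x < M
    F′<M eq = let t , Ft , q≡ = F′-elim eq in ≤-<-trans (≤-trans (≤-reflexive (sym q≡)) (quotient-≤ t)) (F<M Ft)

    N⁺ : ∀ {y} → (E [ (λ x → F′ x ≡ true) ]) y → y < bound M × N y ≡ true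
    N⁺ {y} (x , F′x , Exy) = let t , Ft , q≡ = F′-elim F′x
                                 ty = trans (cong (λ x → adj x y) q≡) (E⇒adj Exy) in
      bound-bounds (E⇒adj Exy) (F′<M F′x) ,
      any-intro {P = λ t → F t ∧ slotAdj t y} (slotBound-bounds {t} ty (n<1+n y)) (∧-intro Ft ty)

    N⁻ : ∀ {y} → N y ≡ true → (E [ (λ x → F′ x ≡ true) ]) y
    N⁻ {y} eq =
      let t , _ , p = any-elim {slotBound (suc y)} eq
          q≤t , t<q = quotient-spec t
      in quotient t ,
         -- The remainder of `t` tells which of the five copies it is.
         any-intro {t ∸ 5 * quotient t} {P = λ i → F (i + 5 * quotient t)}
           (+-cancelʳ-< (5 * quotient t) _ 5 (≤-<-trans (≤-reflexive (m∸n+n≡m q≤t)) (<-≤-trans t<q (≤-reflexive (*-suc 5 (quotient t))))))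
           (trans (cong F (m∸n+n≡m q≤t)) (∧-elimˡ p)) ,
         adj⇒E (∧-elimʳ {F t} p)

  open Matching slotAdj bound slotBound
    (λ {t} tz t<m → bound-bounds tz (≤-<-trans (quotient-≤ t) t<m)) slotBound-bounds slot-expansion
    using (match; match-adjacent; match-injective; match-rec)

  -- A vertex that is nobody's child becomes its own parent. This is a cycle of length one, and
  -- since every path meets a cut, the vertex ends up as a root.
  parent : ℕ → ℕ
  parent y = if any (slotBound (suc y)) (λ t → match t ≡ᵇ y)
             then quotient (least (slotBound (suc y)) (λ t → match t ≡ᵇ y))
             else y

  parent-match : ∀ t → parent (match t) ≡ quotient t
  parent-match t = trans
    (cong (λ b → if b then quotient (least n P) else match t) (any-intro {P = P} t<n (≡ᵇ-complete {match t} refl)))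
    (cong quotient (match-injective (≡ᵇ-sound (least-found {P = P} t<n (≡ᵇ-complete {match t} refl)))))
    where
    n : ℕ
    n = slotBound (suc (match t))
    P : ℕ → Bool
    P s = match s ≡ᵇ match t
    t<n : t < n
    t<n = slotBound-bounds {t} (match-adjacent t) (n<1+n (match t))

  parent-adj : ∀ y → parent y ≡ y ⊎ adj (parent y) y ≡ true
  parent-adj y = go (any n P) refl
    where
    n : ℕ
    n = slotBound (suc y)
    P : ℕ → Bool
    P t = match t ≡ᵇ y
    go : ∀ b → any n P ≡ b → parent y ≡ y ⊎ adj (parent y) y ≡ true
    go false eq = inj₁ (cong (λ b → if b then quotient (least n P) else y) eq)
    go true  eq = let t , _ , t≡y = any-elim {n} {P} eq in
      inj₂ (subst (λ z → adj (parent z) z ≡ true) (≡ᵇ-sound {match t} t≡y)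
        (trans (cong (λ x → adj x (match t)) (parent-match t)) (match-adjacent t)))

  -- The five copies of `w` have five different partners, all children of `w`. As neighbours of `w`
  -- they lie below `bound (suc w)`, hence the `bound ∘ suc` handed to the forest.
  parent-wide : ∀ w → 5 ≤ count (bound (suc w)) λ u → parent u ≡ᵇ w
  parent-wide w = count-injection (λ i → match (i + 5 * w))
    (λ {i} {j} _ _ eq → +-cancelʳ-≡ (5 * w) i j (match-injective eq))
    λ {i} i<5 →
      bound-bounds (match-adjacent (i + 5 * w)) (s≤s (≤-reflexive (quotient-+ w i<5))) ,
      ≡ᵇ-complete (trans (parent-match (i + 5 * w)) (quotient-+ w i<5))

  open Forest parent (bound ∘ suc) parent-wide using (partner-up; partner-down; partner-rec; colour; depth)
  open Walks parent (bound ∘ suc) parent-wide public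

  -- A coloured vertex is deeper than its parent, so it is not its own parent and the edge between
  -- them comes from the matching.
  parent-E : ∀ (c : Colour) u → colour u ≡ toℕ c → E (parent u) u
  parent-E c u col = Sum.[ (λ p≡u → contradiction
    (trans (sym (depth-coloured {u} {c} col)) (cong depth (sym p≡u))) 1+n≢n) , adj⇒E ]′ (parent-adj u)

  step-E : ∀ c v → E v (step c v)
  step-E c v = go (colour v ≟ toℕ c)
    where
    go : Dec (colour v ≡ toℕ c) → E v (step c v)
    go (yes col) = subst (E v) (sym (partner-up v col)) (E-sym (parent-E c v col))
    go (no  ≢c)  = let p≡v , col = partner-down v (Fin.toℕ<n c) ≢c in
      subst (λ u → E u (step c v)) p≡v (parent-E c (step c v) col)

  generated⊆wobbling : ∀ {ℓ} (𝓔 : CoarseSpace ℕ ℓ) → CoarseSpace.IsEntourage 𝓔 E →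
                       Generated (Sym ℕ) Generators ⊆ Wobbling 𝓔
  generated⊆wobbling 𝓔 E∈𝓔 = go
    where
    open CoarseSpace 𝓔 using (downward)
    open IsSubgroup (wobbling-isSubgroup 𝓔)

    perm∈W : ∀ c → Wobbling 𝓔 (perm c)
    perm∈W c = downward (λ { {x} refl → step-E c x }) E∈𝓔

    go : Generated (Sym ℕ) Generators ⊆ Wobbling 𝓔
    go (gen (inj₁ refl)) = ∙-closed {perm 0F} {perm 1F} (perm∈W 0F) (perm∈W 1F)
    go (gen (inj₂ refl)) = ∙-closed {perm 1F} {perm 2F} (perm∈W 1F) (perm∈W 2F)
    go (resp {α} {β} eq α∈) = IsSubgroup.resp (wobbling-isSubgroup 𝓔) {α} {β} eq (go α∈)
    go unit              = ε-closed
    go (mul {α} {β} α∈ β∈) = ∙-closed {α} {β} (go α∈) (go β∈)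
    go (inv {α} α∈)      = ⁻¹-closed {α} (go α∈)

  χ-rec : Recursive {2} λ xs → χ (lookup xs 0F) (lookup xs 1F)
  χ-rec = let e , computes = proj₁ (proj₂ computable) in recursive e λ { (x ∷ y ∷ []) → computes x y }

  adj-rec : ∀ {N} {f g : Vec ℕ N → ℕ} → Recursive f → Recursive g → RecursiveP (λ xs → adj (f xs) (g xs))
  adj-rec rf rg = ≡ᵇ-rec (app₂ χ-rec rf rg) (const-rec 1)

  rowBound-rec : Recursive {1} λ xs → rowBound (lookup xs 0F)
  rowBound-rec = search-rec
    (≡ᵇ-rec (count-rec (var 0F) (adj-rec (var 2F) (var 0F))) (app₁ rowSize-rec (var 1F)))
    (λ xs → rowBound (lookup xs 0F)) (λ xs → rowBound-found (lookup xs 0F)) (λ xs → rowBound-least (lookup xs 0F))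
    where
    rowSize-rec : Recursive {1} λ xs → rowSize (lookup xs 0F)
    rowSize-rec = let e , computes = proj₁ (proj₂ size) in recursive e λ { (x ∷ []) → computes x }

  bound-rec : ∀ {N} {f : Vec ℕ N → ℕ} → Recursive f → Recursive (λ xs → bound (f xs))
  bound-rec rf = app₁ {f = λ xs → bound (lookup xs 0F)}
    (primrec (λ k _ → bound k) (const-rec 0) (⊔-rec (app₁ rowBound-rec (var 0F)) (var 1F)) (λ _ _ → refl) (var 0F))
    rf

  slotBound-rec : ∀ {N} {f : Vec ℕ N → ℕ} → Recursive f → Recursive (λ xs → slotBound (f xs))
  slotBound-rec rf = *-rec (const-rec 5) (bound-rec rf)

  parent-rec : Recursive {1} λ xs → parent (lookup xs 0F)
  parent-rec = if-rec
    (any-rec (slotBound-rec (suc-rec (var 0F))) (≡ᵇ-rec (match-rec′ (var 0F)) (var 1F)))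
    (quotient-rec (least-rec (slotBound-rec (suc-rec (var 0F))) (≡ᵇ-rec (match-rec′ (var 0F)) (var 1F))))
    (var 0F)
    where
    match-rec′ : ∀ {N} {f : Vec ℕ N → ℕ} → Recursive f → Recursive (λ xs → match (f xs))
    match-rec′ = match-rec (adj-rec (quotient-rec (var 0F)) (var 1F)) (bound-rec (var 0F)) (slotBound-rec (var 0F))

  step-rec : ∀ {N} {f : Vec ℕ N → ℕ} c → Recursive f → Recursive (λ xs → step c (f xs))
  step-rec c = partner-rec parent-rec (bound-rec (suc-rec (var 0F))) (toℕ c)

  σ-computable : ComputablePermutation σ
  σ-computable = toComputable (step-rec 0F (step-rec 1F (var 0F)))

  π-computable : ComputablePermutation π
  π-computable = toComputable (step-rec 1F (step-rec 2F (var 0F)))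

theorem2 : ∀ {ℓ : Level} (𝓔 : CoarseSpace ℕ ℓ) →
    BoundedGeometry 𝓔 →
    NonAmenable 𝓔 →
    (∃[ E ] CoarseSpace.IsEntourage 𝓔 E × HighlyComputable E ×
    (∀ (F : Pred ℕ 0ℓ) (m k : ℕ) →
    HasSize F m → HasSize (E [ F ]) k → k ≥ 6 * m)) →
    ∃[ σ ] ∃[ π ] ComputablePermutation σ × ComputablePermutation π ×
    FreeOfRank 2 (subgroup (Sym ℕ) (generated-isSubgroup (Sym ℕ) (｛ σ ｝ ∪ ｛ π ｝))) ×
    SemiRegular (Generated (Sym ℕ) (｛ σ ｝ ∪ ｛ π ｝)) ×
    Generated (Sym ℕ) (｛ σ ｝ ∪ ｛ π ｝) ⊆ Wobbling 𝓔
theorem2 𝓔 _ _ (E , E∈𝓔 , E-hc , expands) =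
  σ , π , σ-computable , π-computable , free , semiRegular , generated⊆wobbling 𝓔 E∈𝓔
  where open Construction E E-hc expands
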